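{- For every integer $k\geq 3$ and every prime $p\geq k$ there are constants $C<\infty$ and $c>0$ such that the following holds. Let $S\subseteq\mathbb{F}_p^n$ be a random set formed by selecting at most $\binom{n+k-2}{k-1}-C(\log_p n)^2 n^{k-2}$ elements of $\mathbb{F}_p^n$ independently and uniformly at random. Then with probability $1-o(1)$ (as $n\to\infty$) there is a set $A\subseteq\mathbb{F}_p^n$ with $|A|\geq c\,p^n$ that contains no proper $k$-term arithmetic progression with common difference in $S$.
   Context: A proper $k$-term arithmetic progression with common difference $y$ in $\mathbb{F}_p^n$ is a sequence $x, x+y, x+2y,\dots,x+(k-1)y$ with $x\in\mathbb{F}_p^n$ and $y\neq 0$; it has common difference in $S$ if $y\in S$. -}

module Defs where

open import Data.Nat using (ℕ; zero; suc; _+_; _*_; _∸_; _^_; _≤_; NonZero)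
open import Data.Nat.DivMod using (_mod_)
open import Data.Nat.Combinatorics using (_C_)
open import Data.Fin using (Fin; toℕ)
open import Data.Vec using (Vec; zipWith; replicate; lookup)
open import Data.List using (List; length)
open import Data.List.Membership.Propositional using (_∈_)
open import Data.List.Relation.Unary.Unique.Propositional using (Unique)
open import Data.Product using (Σ; ∃; _×_)
open import Relation.Binary.PropositionalEquality using (_≡_; _≢_)
open import Relation.Nullary using (¬_)

𝔽^ : (p n : ℕ) → Set
𝔽^ p n = Vec (Fin p) n

zeroV : (p n : ℕ) .{{_ : NonZero p}} → 𝔽^ p n
zeroV p n = replicate n (0 mod p)

apTerm : {p n : ℕ} .{{_ : NonZero p}} → 𝔽^ p n → 𝔽^ p n → ℕ → 𝔽^ p n
apTerm {p} x y j = zipWith (λ a b → (toℕ a + j * toℕ b) mod p) x y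

-- the random multiset S = {s_1,...,s_m} (as a vector of m picks)
_∈S_ : {p n m : ℕ} → 𝔽^ p n → Vec (𝔽^ p n) m → Set
_∈S_ {m = m} y s = ∃ λ (i : Fin m) → lookup s i ≡ y

NoAPdiffIn : (p k n m : ℕ) .{{_ : NonZero p}} → List (𝔽^ p n) → Vec (𝔽^ p n) m → Set
NoAPdiffIn p k n m A s =
  (x y : 𝔽^ p n) → y ∈S s → y ≢ zeroV p n →
  ¬ ((j : Fin k) → apTerm x y (toℕ j) ∈ A)

Good : (p k d n m : ℕ) .{{_ : NonZero p}} → Vec (𝔽^ p n) m → Set
Good p k d n m s = Σ (List (𝔽^ p n)) λ A →
  Unique A × p ^ n ≤ d * length A × NoAPdiffIn p k n m A s

-- m ≤ binom(n+k-2, k-1) - C (log_p n)^2 n^(k-2), encoded in ℕ: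
-- (log_p n)^2 ≤ X  iff  every rational a/b with p^a ≤ n^b satisfies (a/b)^2 ≤ X
SizeOK : (p k K n m : ℕ) → Set
SizeOK p k K n m = (a b : ℕ) → 1 ≤ b → p ^ a ≤ n ^ b →
  a * a * K * n ^ (k ∸ 2) + m * (b * b) ≤ ((n + k ∸ 2) C (k ∸ 1)) * (b * b)

{-# OPTIONS --safe #-}
module Submission where

-- Put d = k - 1.  If q is a multilinear form of degree d with q(y) ≠ 0, no level set of q contains
-- x, x + y, ..., x + d y, because the d-th difference of q along this progression is d! q(y) ≠ 0;
-- and some level set has density at least 1/p.  So it suffices that with high probability some q
-- vanishes at none of the random points.  Adding the points one at a time, this can be maintained
-- unless the new point is a common zero of all forms vanishing at the i < m earlier points.
-- Such common zeros are rare: linear algebra gives a nonzero form q₁ vanishing at the earlier points;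
-- let B₁ be the d variables of one of its monomials.  The forms free of B₁ still span more
-- than i dimensions, giving q₂, B₂, and so on for t steps.  Since q₂, ..., q_t do not involve B₁, and
-- q₁ is nonzero for at least one of the p^d values of the B₁-variables, induction bounds the density
-- of common zeros by (1 - p^-d)^t.  Taking t a multiple of log n beats the union bound over m ≤ (2n)^d
-- points, at a cost of O(t n^(d-1)) dimensions.  Restricting to multilinear forms costs only
-- binom(n+d-1, d) - binom(n, d) = O(n^(d-1)) more.

open import Defs
open import Data.Nat as ℕ using (ℕ; zero; suc; _^_; _∸_; _≤_; _<_; z≤n; s≤s; z<s; s≤s⁻¹; _!; NonZero)
import Data.Nat.Properties as ℕ
import Data.Nat.Divisibility as ℕ
open import Data.Nat.Combinatorics using (nCk≡nC[n∸k]; nCn≡1; nCk+nC[k+1]≡[n+1]C[k+1]; k>n⇒nCk≡0) renaming (_C_ to _choose_)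
open import Data.Nat.DivMod using (_mod_; m≡m%n+[m/n]*n; m%n<n)
open import Data.Nat.ListAction using (sum)
open import Data.Nat.ListAction.Properties using (sum-++)
open import Data.Nat.Primality using (Prime; euclidsLemma; prime⇒nonZero; prime⇒nonTrivial)
open import Data.Nat.Tactic.RingSolver using () renaming (solve-∀ to solve-∀ℕ)
open import Data.Integer using (ℤ; +_; _+_; _*_; _-_; -_; ∣_∣; 0ℤ; 1ℤ)
import Data.Integer.Properties as ℤ
open import Data.Integer.DivMod using (_%ℕ_; _/ℕ_; n%ℕd<d; a≡a%ℕn+[a/ℕn]*n)
open import Data.Integer.Divisibility.Signed using (_∣_; divides; _∣?_; ∣⇒∣ᵤ; ∣ᵤ⇒∣; ∣m∣n⇒∣m+n; ∣m∣n⇒∣m-n; ∣m+n∣m⇒∣n; ∣m+n∣n⇒∣m; ∣n⇒∣m*n; ∣m⇒∣m*n)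
open import Data.Integer.Tactic.RingSolver using (solve-∀)
open import Data.Bool using (Bool; true; false; not; _∧_; T; T?; if_then_else_)
open import Data.Bool.ListAction using (all)
open import Data.Fin as Fin using (Fin; zero; suc; toℕ; fromℕ<)
import Data.Fin.Properties as Fin
open import Data.Vec as Vec using (Vec; []; _∷_; _++_; zipWith; head; tail; take; drop)
open import Data.Vec.Properties using (take++drop≡id; ∷-injective; ∷-injectiveˡ)
open import Data.Vec.Relation.Unary.All as VAll using ([]; _∷_) renaming (All to VAll)
import Data.Vec.Relation.Unary.All.Properties as VAll
open import Data.Vec.Relation.Unary.Any as VAny using (here; there) renaming (Any to VAny)
import Data.Vec.Relation.Unary.Any.Properties as VAny
open import Data.List as List using (List; []; _∷_; length; allFin; filter; cartesianProductWith)
open import Data.List.Properties using (map-++; length-++; length-map; length-filter; length-tabulate)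
open import Data.List.Membership.Propositional using (_∈_)
open import Data.List.Membership.Propositional.Properties using (∈-allFin; ∈-filter⁻; ∈-map⁻; ∈-++⁻)
open import Data.List.Relation.Unary.Any using (here; there)
open import Data.List.Relation.Unary.All as All using (All; []; _∷_)
import Data.List.Relation.Unary.All.Properties as All
open import Data.List.Relation.Unary.AllPairs using ([]; _∷_)
open import Data.List.Relation.Unary.Unique.Propositional using (Unique)
import Data.List.Relation.Unary.Unique.Propositional.Properties as Unique
open import Data.Product using (Σ; ∃; _×_; _,_; proj₂)
open import Data.Sum using (_⊎_; inj₁; inj₂)
open import Data.Unit using (tt)
open import Data.Empty using (⊥-elim)
open import Function using (_∘_; id)
open import Relation.Nullary using (¬_; Dec; yes; no; does)
open import Relation.Nullary.Decidable using (dec-true)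
open import Relation.Binary.PropositionalEquality using (_≡_; refl; sym; trans; cong; cong₂; subst; module ≡-Reasoning)

-- Multilinear forms with integer coefficients

-- con c is a constant, nil the zero form in no variables, and q ∙ r is q + x₀ r with x₀ the first
-- variable; so Poly n d consists of the multilinear forms of degree d in n variables.
data Poly : ℕ → ℕ → Set where
  con : ∀ {n} → ℤ → Poly n 0
  nil : ∀ {d} → Poly 0 (suc d)
  _∙_ : ∀ {n d} → Poly n (suc d) → Poly n d → Poly (suc n) (suc d)

eval : ∀ {n d} → Poly n d → Vec ℤ n → ℤ
eval (con c) _        = c
eval nil     _        = 0ℤ
eval (q ∙ r) (x ∷ xs) = eval q xs + x * eval r xs

-- Finite differences along a progression

Δ : (ℕ → ℤ) → ℕ → ℤ
Δ h j = h (suc j) - h j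

Δ^ : ℕ → (ℕ → ℤ) → ℕ → ℤ
Δ^ zero    h = h
Δ^ (suc m) h = Δ (Δ^ m h)

Δ^-+ : ∀ m g h j → Δ^ m (λ i → g i + h i) j ≡ Δ^ m g j + Δ^ m h j
Δ^-+ zero    g h j = refl
Δ^-+ (suc m) g h j = trans (cong₂ _-_ (Δ^-+ m g h (suc j)) (Δ^-+ m g h j))
  (interchange (Δ^ m g (suc j)) (Δ^ m h (suc j)) (Δ^ m g j) (Δ^ m h j))
  where
  interchange : ∀ a b c e → (a + b) - (c + e) ≡ (a - c) + (b - e)
  interchange = solve-∀

Δ^-zero : ∀ m j → Δ^ m (λ _ → 0ℤ) j ≡ 0ℤ
Δ^-zero zero    j = refl
Δ^-zero (suc m) j = cong₂ _-_ (Δ^-zero m (suc j)) (Δ^-zero m j)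

line : ℤ → ℤ → ℕ → ℤ
line x y j = x + + j * y

line-suc : ∀ x y j → line x y (suc j) ≡ line x y j + y
line-suc x y j = trans (cong (λ z → x + z * y) (ℤ.pos-+ 1 j)) (expand x y (+ j))
  where
  expand : ∀ x y j → x + (1ℤ + j) * y ≡ x + j * y + y
  expand = solve-∀

-- Leibniz rule for differences: the linear factor has constant first difference y and vanishing
-- higher ones, so only two terms survive.
Δ^-leibniz : ∀ x y h m j →
  Δ^ (suc m) (λ i → line x y i * h i) j ≡
  line x y j * Δ^ (suc m) h j + + suc m * y * Δ^ m h (suc j)
Δ^-leibniz x y h zero j =
  trans (cong (λ z → z * h (suc j) - line x y j * h j) (line-suc x y j))
        (expand (line x y j) y (h (suc j)) (h j))
  where
  expand : ∀ g y a b → (g + y) * a - g * b ≡ g * (a - b) + + 1 * y * a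
  expand = solve-∀
Δ^-leibniz x y h (suc m) j = begin
  Δ^ (suc m) f (suc j) - Δ^ (suc m) f j
    ≡⟨ cong₂ _-_ (Δ^-leibniz x y h m (suc j)) (Δ^-leibniz x y h m j) ⟩
  (line x y (suc j) * (a - b) + + suc m * y * a)
    - (line x y j * (b - c) + + suc m * y * b)
    ≡⟨ cong (λ z → (z * (a - b) + + suc m * y * a)
                     - (line x y j * (b - c) + + suc m * y * b)) (line-suc x y j) ⟩
  ((line x y j + y) * (a - b) + + suc m * y * a)
    - (line x y j * (b - c) + + suc m * y * b)
    ≡⟨ expand (line x y j) y (+ suc m) a b c ⟩
  line x y j * ((a - b) - (b - c)) + (1ℤ + + suc m) * y * (a - b)
    ≡⟨ cong (λ z → line x y j * ((a - b) - (b - c)) + z * y * (a - b))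
            (sym (ℤ.pos-+ 1 (suc m))) ⟩
  line x y j * ((a - b) - (b - c)) + + suc (suc m) * y * (a - b) ∎
  where
  open ≡-Reasoning
  f = λ i → line x y i * h i
  a = Δ^ m h (suc (suc j))
  b = Δ^ m h (suc j)
  c = Δ^ m h j
  expand : ∀ g y k a b c →
    ((g + y) * (a - b) + k * y * a) - (g * (b - c) + k * y * b) ≡
    g * ((a - b) - (b - c)) + (1ℤ + k) * y * (a - b)
  expand = solve-∀

lineV : ∀ {n} → Vec ℤ n → Vec ℤ n → ℕ → Vec ℤ n
lineV x y j = zipWith (λ a b → line a b j) x y

-- Write the form as q + x₀ r. By induction the d-th difference of r is constant, so the first
-- Leibniz term is 0, and the factor d + 1 of the second turns d! into (d + 1)!.
Δ^-eval : ∀ {n d} (q : Poly n d) x y j →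
  Δ^ d (λ i → eval q (lineV x y i)) j ≡ + (d !) * eval q y
Δ^-eval (con c) x y j = sym (ℤ.*-identityˡ c)
Δ^-eval (nil {d}) [] [] j = trans (Δ^-zero (suc d) j) (sym (ℤ.*-zeroʳ (+ (suc d !))))
Δ^-eval (_∙_ {d = d} q r) (x ∷ xs) (y ∷ ys) j = begin
  Δ^ (suc d) (λ i → f i + line x y i * h i) j
    ≡⟨ Δ^-+ (suc d) f (λ i → line x y i * h i) j ⟩
  Δ^ (suc d) f j + Δ^ (suc d) (λ i → line x y i * h i) j
    ≡⟨ cong₂ _+_ (Δ^-eval q xs ys j) (Δ^-leibniz x y h d j) ⟩
  + (suc d !) * v + (line x y j * (Δ^ d h (suc j) - Δ^ d h j) + + suc d * y * Δ^ d h (suc j))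
    ≡⟨ cong₂ (λ a b → + (suc d !) * v + (line x y j * (a - b) + + suc d * y * a))
             (Δ^-eval r xs ys (suc j)) (Δ^-eval r xs ys j) ⟩
  + (suc d !) * v + (line x y j * (+ (d !) * w - + (d !) * w) + + suc d * y * (+ (d !) * w))
    ≡⟨ cong (λ z → z * v + (line x y j * (+ (d !) * w - + (d !) * w)
                              + + suc d * y * (+ (d !) * w)))
            (ℤ.pos-* (suc d) (d !)) ⟩
  + suc d * + (d !) * v + (line x y j * (+ (d !) * w - + (d !) * w) + + suc d * y * (+ (d !) * w))
    ≡⟨ collect (+ suc d) (+ (d !)) v w (line x y j) y ⟩
  + suc d * + (d !) * (v + y * w)
    ≡⟨ cong (_* (v + y * w)) (sym (ℤ.pos-* (suc d) (d !))) ⟩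
  + (suc d !) * (v + y * w) ∎
  where
  open ≡-Reasoning
  f = λ i → eval q (lineV xs ys i)
  h = λ i → eval r (lineV xs ys i)
  v = eval q ys
  w = eval r ys
  collect : ∀ k c v w g y → k * c * v + (g * (c * w - c * w) + k * y * (c * w)) ≡ k * c * (v + y * w)
  collect = solve-∀

-- Sums, dimension and coefficient vectors

addP : ∀ {n d} → Poly n d → Poly n d → Poly n d
addP (con a) (con b)   = con (a + b)
addP nil     nil       = nil
addP (q ∙ r) (q′ ∙ r′) = addP q q′ ∙ addP r r′

eval-addP : ∀ {n d} (q r : Poly n d) x → eval (addP q r) x ≡ eval q x + eval r x
eval-addP (con a) (con b)   x        = refl
eval-addP nil     nil       x        = refl
eval-addP (q ∙ r) (q′ ∙ r′) (x ∷ xs) =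
  trans (cong₂ (λ a b → a + x * b) (eval-addP q q′ xs) (eval-addP r r′ xs))
        (distribute (eval q xs) (eval q′ xs) x (eval r xs) (eval r′ xs))
  where
  distribute : ∀ a a′ x b b′ → a + a′ + x * (b + b′) ≡ a + x * b + (a′ + x * b′)
  distribute = solve-∀

-- The binomial coefficient binom(n, d) by Pascal's rule, in the shape of `Poly`, so that
-- coefficient vectors split along the same recursion.
dim : ℕ → ℕ → ℕ
dim _       zero    = 1
dim zero    (suc _) = 0
dim (suc n) (suc d) = dim n (suc d) ℕ.+ dim n d

dim-mono : ∀ {m n} d → m ≤ n → dim m d ≤ dim n d
dim-mono zero    _         = ℕ.≤-refl
dim-mono (suc d) z≤n       = z≤n
dim-mono (suc d) (s≤s m≤n) = ℕ.+-mono-≤ (dim-mono (suc d) m≤n) (dim-mono d m≤n)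

dot : ∀ {n} → Vec ℤ n → Vec ℤ n → ℤ
dot []       []       = 0ℤ
dot (x ∷ xs) (y ∷ ys) = x * y + dot xs ys

dot-++ : ∀ {m n} (u u′ : Vec ℤ m) (v v′ : Vec ℤ n) →
  dot (u ++ v) (u′ ++ v′) ≡ dot u u′ + dot v v′
dot-++ []      []        v v′ = sym (ℤ.+-identityˡ _)
dot-++ (x ∷ u) (x′ ∷ u′) v v′ =
  trans (cong (λ s → x * x′ + s) (dot-++ u u′ v v′)) (sym (ℤ.+-assoc (x * x′) (dot u u′) (dot v v′)))

dot-zeroʳ : ∀ {n} (u : Vec ℤ n) → dot u (Vec.replicate n 0ℤ) ≡ 0ℤ
dot-zeroʳ []      = refl
dot-zeroʳ (x ∷ u) = trans (cong₂ _+_ (ℤ.*-zeroʳ x) (dot-zeroʳ u)) refl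

dot-scaleˡ : ∀ {n} a (u v : Vec ℤ n) → dot (Vec.map (a *_) u) v ≡ a * dot u v
dot-scaleˡ a []      []      = sym (ℤ.*-zeroʳ a)
dot-scaleˡ a (x ∷ u) (y ∷ v) =
  trans (cong (λ s → a * x * y + s) (dot-scaleˡ a u v)) (factor a x y (dot u v))
  where
  factor : ∀ a x y s → a * x * y + a * s ≡ a * (x * y + s)
  factor = solve-∀

dot-comm : ∀ {n} (u v : Vec ℤ n) → dot u v ≡ dot v u
dot-comm []      []      = refl
dot-comm (x ∷ u) (y ∷ v) = cong₂ _+_ (ℤ.*-comm x y) (dot-comm u v)

dot-combine : ∀ {n} a b (u v w : Vec ℤ n) →
  dot (zipWith (λ x y → a * x - b * y) u v) w ≡ a * dot u w - b * dot v w
dot-combine a b []      []      []      = zeros a b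
  where
  zeros : ∀ a b → 0ℤ ≡ a * 0ℤ - b * 0ℤ
  zeros = solve-∀
dot-combine a b (x ∷ u) (y ∷ v) (z ∷ w) =
  trans (cong (λ s → (a * x - b * y) * z + s) (dot-combine a b u v w))
        (regroup a b x y z (dot u w) (dot v w))
  where
  regroup : ∀ a b x y z s t →
    (a * x - b * y) * z + (a * s - b * t) ≡ a * (x * z + s) - b * (y * z + t)
  regroup = solve-∀

-- Row operation by cross-multiplication with the pivot row `a ∷ u`: the leading entry a b - b a is
-- 0 and is dropped.
eliminate : ∀ {n} → ℤ → Vec ℤ n → Vec ℤ (suc n) → Vec ℤ n
eliminate a u (b ∷ v) = zipWith (λ x y → a * x - b * y) v u

-- Listed in the order in which `fromCoeffs` reads coefficients, which makes evaluation at a point a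
-- linear functional of the coefficients.
monomials : ∀ {n} d → Vec ℤ n → Vec ℤ (dim n d)
monomials zero    _        = 1ℤ ∷ []
monomials (suc d) []       = []
monomials (suc d) (x ∷ xs) = monomials (suc d) xs ++ Vec.map (x *_) (monomials d xs)

fromCoeffs : ∀ n d → Vec ℤ (dim n d) → Poly n d
fromCoeffs n       zero    (c ∷ []) = con c
fromCoeffs zero    (suc d) []       = nil
fromCoeffs (suc n) (suc d) c        =
  fromCoeffs n (suc d) (take (dim n (suc d)) c) ∙ fromCoeffs n d (drop (dim n (suc d)) c)

eval-fromCoeffs : ∀ n d (c : Vec ℤ (dim n d)) x →
  eval (fromCoeffs n d c) x ≡ dot (monomials d x) c
eval-fromCoeffs n       zero    (c ∷ []) x        = sym (trans (ℤ.+-identityʳ _) (ℤ.*-identityˡ c))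
eval-fromCoeffs zero    (suc d) []       []       = refl
eval-fromCoeffs (suc n) (suc d) c        (x ∷ xs) = begin
  eval (fromCoeffs n (suc d) c₁) xs + x * eval (fromCoeffs n d c₂) xs
    ≡⟨ cong₂ (λ a b → a + x * b) (eval-fromCoeffs n (suc d) c₁ xs) (eval-fromCoeffs n d c₂ xs) ⟩
  dot u c₁ + x * dot v c₂
    ≡⟨ cong (λ s → dot u c₁ + s) (sym (dot-scaleˡ x v c₂)) ⟩
  dot u c₁ + dot (Vec.map (x *_) v) c₂
    ≡⟨ sym (dot-++ u c₁ (Vec.map (x *_) v) c₂) ⟩
  dot (u ++ Vec.map (x *_) v) (c₁ ++ c₂)
    ≡⟨ cong (dot (u ++ Vec.map (x *_) v)) (take++drop≡id (dim n (suc d)) c) ⟩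
  dot (u ++ Vec.map (x *_) v) c ∎
  where
  open ≡-Reasoning
  c₁ = take (dim n (suc d)) c
  c₂ = drop (dim n (suc d)) c
  u = monomials (suc d) xs
  v = monomials d xs

zeroP : ∀ n d → Poly n d
zeroP n       zero    = con 0ℤ
zeroP zero    (suc d) = nil
zeroP (suc n) (suc d) = zeroP n (suc d) ∙ zeroP n d

eval-zeroP : ∀ n d x → eval (zeroP n d) x ≡ 0ℤ
eval-zeroP n       zero    x        = refl
eval-zeroP zero    (suc d) x        = refl
eval-zeroP (suc n) (suc d) (x ∷ xs) =
  trans (cong₂ (λ a b → a + x * b) (eval-zeroP n (suc d) xs) (eval-zeroP n d xs))
        (trans (ℤ.+-identityˡ _) (ℤ.*-zeroʳ x))

-- Deletion of coordinates

-- Sel n e r chooses e of n coordinates, to be deleted, leaving r.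
data Sel : ℕ → ℕ → ℕ → Set where
  done : ∀ {n} → Sel n 0 n
  skip : ∀ {n e r} → Sel n e r → Sel (suc n) e (suc r)
  pick : ∀ {n e r} → Sel n e r → Sel (suc n) (suc e) r

Sel-size : ∀ {n e r} → Sel n e r → n ≡ e ℕ.+ r
Sel-size done                   = refl
Sel-size (skip {e = e} {r = r} s) = trans (cong suc (Sel-size s)) (sym (ℕ.+-suc e r))
Sel-size (pick s)               = cong suc (Sel-size s)

delete : ∀ {A : Set} {n e r} → Sel n e r → Vec A n → Vec A r
delete done     xs       = xs
delete (skip s) (x ∷ xs) = x ∷ delete s xs
delete (pick s) (x ∷ xs) = delete s xs

map-delete : ∀ {A B : Set} (f : A → B) {n e r} (s : Sel n e r) xs →
  Vec.map f (delete s xs) ≡ delete s (Vec.map f xs)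
map-delete f done     xs       = refl
map-delete f (skip s) (x ∷ xs) = cong (f x ∷_) (map-delete f s xs)
map-delete f (pick s) (x ∷ xs) = map-delete f s xs

-- A form in the surviving variables, regarded as one in all n: a deleted variable gets the zero
-- form as cofactor.
pullback : ∀ {n e r d} → Sel n e r → Poly r d → Poly n d
pullback done q                    = q
pullback (skip s) (con c)          = con c
pullback (skip s) (q ∙ q′)         = pullback s q ∙ pullback s q′
pullback {d = zero}  (pick s) (con c) = con c
pullback {d = suc d} (pick s) q    = pullback s q ∙ zeroP _ d

eval-pullback : ∀ {n e r d} (s : Sel n e r) (q : Poly r d) x →
  eval (pullback s q) x ≡ eval q (delete s x)
eval-pullback done     q        x        = refl
eval-pullback (skip s) (con c)  (x ∷ xs) = refl
eval-pullback (skip s) (q ∙ q′) (x ∷ xs) =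
  cong₂ (λ a b → a + x * b) (eval-pullback s q xs) (eval-pullback s q′ xs)
eval-pullback {d = zero}  (pick s) (con c) (x ∷ xs) = refl
eval-pullback {d = suc d} (pick s) q       (x ∷ xs) =
  trans (cong₂ (λ a b → a + x * b) (eval-pullback s q xs) (eval-zeroP _ d xs))
        (trans (cong (λ z → eval q (delete s xs) + z) (ℤ.*-zeroʳ x)) (ℤ.+-identityʳ _))

-- Finite sums, indicators and the pigeonhole principle

Σ[_] : {A : Set} → List A → (A → ℕ) → ℕ
Σ[ xs ] f = sum (List.map f xs)

Σ-mono : ∀ {A : Set} (xs : List A) {f g : A → ℕ} → (∀ x → f x ≤ g x) → Σ[ xs ] f ≤ Σ[ xs ] g
Σ-mono []       f≤g = z≤n
Σ-mono (x ∷ xs) f≤g = ℕ.+-mono-≤ (f≤g x) (Σ-mono xs f≤g)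

Σ-cong : ∀ {A : Set} (xs : List A) {f g : A → ℕ} → (∀ x → f x ≡ g x) → Σ[ xs ] f ≡ Σ[ xs ] g
Σ-cong []       f≡g = refl
Σ-cong (x ∷ xs) f≡g = cong₂ ℕ._+_ (f≡g x) (Σ-cong xs f≡g)

Σ-+ : ∀ {A : Set} (xs : List A) (f g : A → ℕ) → Σ[ xs ] (λ x → f x ℕ.+ g x) ≡ Σ[ xs ] f ℕ.+ Σ[ xs ] g
Σ-+ []       f g = refl
Σ-+ (x ∷ xs) f g = trans (cong (λ s → f x ℕ.+ g x ℕ.+ s) (Σ-+ xs f g))
  (interchange (f x) (g x) (Σ[ xs ] f) (Σ[ xs ] g))
  where
  interchange : ∀ a b c e → a ℕ.+ b ℕ.+ (c ℕ.+ e) ≡ a ℕ.+ c ℕ.+ (b ℕ.+ e)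
  interchange = solve-∀ℕ

Σ-const : ∀ {A : Set} (xs : List A) c → Σ[ xs ] (λ _ → c) ≡ length xs ℕ.* c
Σ-const []       c = refl
Σ-const (x ∷ xs) c = cong (c ℕ.+_) (Σ-const xs c)

Σ-* : ∀ {A : Set} (xs : List A) c f → Σ[ xs ] (λ x → c ℕ.* f x) ≡ c ℕ.* Σ[ xs ] f
Σ-* []       c f = sym (ℕ.*-zeroʳ c)
Σ-* (x ∷ xs) c f = trans (cong (λ s → c ℕ.* f x ℕ.+ s) (Σ-* xs c f)) (sym (ℕ.*-distribˡ-+ c (f x) (Σ[ xs ] f)))

Σ-cartesian : ∀ {A B C : Set} (h : A → B → C) xs ys (f : C → ℕ) →
  Σ[ cartesianProductWith h xs ys ] f ≡ Σ[ xs ] (λ x → Σ[ ys ] (λ y → f (h x y)))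
Σ-cartesian h []       ys f = refl
Σ-cartesian h (x ∷ xs) ys f = begin
  sum (List.map f (List.map (h x) ys List.++ cartesianProductWith h xs ys))
    ≡⟨ cong sum (map-++ f (List.map (h x) ys) _) ⟩
  sum (List.map f (List.map (h x) ys) List.++ List.map f (cartesianProductWith h xs ys))
    ≡⟨ sum-++ (List.map f (List.map (h x) ys)) _ ⟩
  Σ[ List.map (h x) ys ] f ℕ.+ Σ[ cartesianProductWith h xs ys ] f
    ≡⟨ cong₂ ℕ._+_ (Σ-map ys) (Σ-cartesian h xs ys f) ⟩
  Σ[ ys ] (λ y → f (h x y)) ℕ.+ Σ[ xs ] (λ x → Σ[ ys ] (λ y → f (h x y))) ∎
  where
  open ≡-Reasoning
  Σ-map : ∀ ys → Σ[ List.map (h x) ys ] f ≡ Σ[ ys ] (λ y → f (h x y))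
  Σ-map []       = refl
  Σ-map (y ∷ ys) = cong (f (h x y) ℕ.+_) (Σ-map ys)

𝟙 : Bool → ℕ
𝟙 b = if b then 1 else 0

𝟙-mono : ∀ b c → (T b → T c) → 𝟙 b ≤ 𝟙 c
𝟙-mono false c     f = z≤n
𝟙-mono true  true  f = s≤s z≤n
𝟙-mono true  false f = ⊥-elim (f tt)

𝟙-union : ∀ a b c → (T a → T b ⊎ T c) → 𝟙 a ≤ 𝟙 b ℕ.+ 𝟙 c
𝟙-union false b     c     f = z≤n
𝟙-union true  true  c     f = s≤s z≤n
𝟙-union true  false true  f = s≤s z≤n
𝟙-union true  false false f with f tt
... | inj₁ ()
... | inj₂ ()

𝟙-split : ∀ a b → 𝟙 (a ∧ b) ℕ.+ 𝟙 (not a ∧ b) ≡ 𝟙 b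
𝟙-split true  b = ℕ.+-identityʳ _
𝟙-split false b = refl

T-∧⁺ : ∀ {a b} → T a → T b → T (a ∧ b)
T-∧⁺ {true} _ t = t

T-∧⁻ : ∀ {a b} → T (a ∧ b) → T a × T b
T-∧⁻ {true} t = tt , t

T-not-does⁺ : ∀ {A : Set} (A? : Dec A) → ¬ A → T (not (does A?))
T-not-does⁺ (yes a) ¬a = ¬a a
T-not-does⁺ (no _)  _  = tt

T-not-does⁻ : ∀ {A : Set} (A? : Dec A) → T (not (does A?)) → ¬ A
T-not-does⁻ (no ¬a) _ = ¬a

-- Two test values for a variable: an affine function of one variable with nonzero slope cannot
-- vanish at both 0 and 1. The record spares writing the modulus as a double successor.
record Bits (q : ℕ) : Set where
  field
    b₀ b₁  : Fin q
    toℕ-b₀ : toℕ b₀ ≡ 0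
    toℕ-b₁ : toℕ b₁ ≡ 1
    b₀+b₁≤ : ∀ f → f b₀ ℕ.+ f b₁ ≤ Σ[ allFin q ] f

bits : ∀ q → 1 < q → Bits q
bits (suc (suc q)) _ = record
  { b₀ = zero ; b₁ = suc zero ; toℕ-b₀ = refl ; toℕ-b₁ = refl
  ; b₀+b₁≤ = λ f → ℕ.+-monoʳ-≤ (f zero) (ℕ.m≤m+n (f (suc zero)) _) }
bits (suc zero) (s≤s ())

length-filter≡Σ : ∀ {A : Set} {P : A → Set} (P? : ∀ x → Dec (P x)) xs →
  length (filter P? xs) ≡ Σ[ xs ] (λ x → 𝟙 (does (P? x)))
length-filter≡Σ P? []       = refl
length-filter≡Σ P? (x ∷ xs) with does (P? x)
... | true  = cong suc (length-filter≡Σ P? xs)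
... | false = length-filter≡Σ P? xs

-- A maximiser over the list together with `x₀` is at least the average; `x₀` also serves the empty
-- list.
argmax : ∀ {A : Set} (f : A → ℕ) → A → (xs : List A) → ∃ λ x → Σ[ xs ] f ≤ length xs ℕ.* f x
argmax f x₀ []       = x₀ , z≤n
argmax f x₀ (y ∷ xs) with argmax f x₀ xs
... | x , h with ℕ.≤-total (f y) (f x)
...   | inj₁ fy≤fx = x , ℕ.+-mono-≤ fy≤fx h
...   | inj₂ fx≤fy = y , ℕ.+-monoʳ-≤ (f y) (ℕ.≤-trans h (ℕ.*-monoʳ-≤ (length xs) fx≤fy))

∈⇒≤Σ : ∀ {A : Set} (f : A → ℕ) {x xs} → x ∈ xs → f x ≤ Σ[ xs ] f
∈⇒≤Σ f {xs = y ∷ xs} (here refl) = ℕ.m≤m+n (f y) _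
∈⇒≤Σ f {xs = y ∷ xs} (there x∈)  = ℕ.≤-trans (∈⇒≤Σ f x∈) (ℕ.m≤n+m _ (f y))

pigeonhole : ∀ {A : Set} {c} (f : A → Fin c) → Fin c → (xs : List A) →
  ∃ λ v → length xs ≤ c ℕ.* length (filter (λ x → f x Fin.≟ v) xs)
pigeonhole {c = c} f v₀ xs with argmax (λ v → length (filter (λ x → f x Fin.≟ v) xs)) v₀ (allFin c)
... | v , h = v , ℕ.≤-trans (covered xs)
    (subst (λ l → Σ[ allFin c ] fibre ≤ l ℕ.* fibre v) (length-tabulate {n = c} id) h)
  where
  fibre = λ v → length (filter (λ x → f x Fin.≟ v) xs)
  covered : ∀ xs → length xs ≤ Σ[ allFin c ] (λ v → length (filter (λ x → f x Fin.≟ v) xs))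
  covered []       = z≤n
  covered (x ∷ xs) = begin
    1 ℕ.+ length xs
      ≤⟨ ℕ.+-mono-≤ (subst (_≤ Σ[ allFin c ] δ) δ-refl (∈⇒≤Σ δ (∈-allFin (f x)))) (covered xs) ⟩
    Σ[ allFin c ] δ ℕ.+ Σ[ allFin c ] (λ v → length (filter (λ x → f x Fin.≟ v) xs))
      ≡⟨ sym (Σ-+ (allFin c) δ _) ⟩
    Σ[ allFin c ] (λ v → δ v ℕ.+ length (filter (λ x → f x Fin.≟ v) xs))
      ≡⟨ Σ-cong (allFin c) (λ v → trans (cong (λ l → δ v ℕ.+ l) (length-filter≡Σ (λ x → f x Fin.≟ v) xs))
           (sym (length-filter≡Σ (λ x → f x Fin.≟ v) (x ∷ xs)))) ⟩
    Σ[ allFin c ] (λ v → length (filter (λ x → f x Fin.≟ v) (x ∷ xs))) ∎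
    where
    open ℕ.≤-Reasoning
    δ = λ v → 𝟙 (does (f x Fin.≟ v))
    δ-refl : δ (f x) ≡ 1
    δ-refl with f x Fin.≟ f x
    ... | yes _ = refl
    ... | no ≢  = ⊥-elim (≢ refl)

-- Binomial coefficients and numerical estimates

dim≡C : ∀ n d → dim n d ≡ n choose d
dim≡C n       zero    = sym (trans (nCk≡nC[n∸k] {0} {n} z≤n) (nCn≡1 n))
dim≡C zero    (suc d) = sym (k>n⇒nCk≡0 {0} {suc d} z<s)
dim≡C (suc n) (suc d) = trans (cong₂ ℕ._+_ (dim≡C n (suc d)) (dim≡C n d))
  (trans (ℕ.+-comm (n choose suc d) (n choose d)) (nCk+nC[k+1]≡[n+1]C[k+1] n d))

dim≤^ : ∀ n d → dim n d ≤ n ^ d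
dim≤^ n       zero    = ℕ.≤-refl
dim≤^ zero    (suc d) = z≤n
dim≤^ (suc n) (suc d) = begin
  dim n (suc d) ℕ.+ dim n d ≤⟨ ℕ.+-mono-≤ (dim≤^ n (suc d)) (dim≤^ n d) ⟩
  n ℕ.* n ^ d ℕ.+ n ^ d     ≡⟨ ℕ.+-comm (n ℕ.* n ^ d) (n ^ d) ⟩
  suc n ℕ.* n ^ d           ≤⟨ ℕ.*-monoʳ-≤ (suc n) (ℕ.^-monoˡ-≤ d (ℕ.n≤1+n n)) ⟩
  suc n ℕ.* suc n ^ d       ∎
  where open ℕ.≤-Reasoning

-- By Pascal's rule each variable removed costs at most binom(n, d) ≤ n^d dimensions.
dim-∸ : ∀ u n d → dim n (suc d) ≤ dim (n ∸ u) (suc d) ℕ.+ u ℕ.* n ^ d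
dim-∸ zero    n       d = ℕ.m≤m+n _ 0
dim-∸ (suc u) zero    d = z≤n
dim-∸ (suc u) (suc n) d = begin
  dim n (suc d) ℕ.+ dim n d
    ≤⟨ ℕ.+-mono-≤ (dim-∸ u n d) (dim≤^ n d) ⟩
  dim (n ∸ u) (suc d) ℕ.+ u ℕ.* n ^ d ℕ.+ n ^ d
    ≡⟨ regroup (dim (n ∸ u) (suc d)) u (n ^ d) ⟩
  dim (n ∸ u) (suc d) ℕ.+ suc u ℕ.* n ^ d
    ≤⟨ ℕ.+-monoʳ-≤ (dim (n ∸ u) (suc d)) (ℕ.*-monoʳ-≤ (suc u) (ℕ.^-monoˡ-≤ d (ℕ.n≤1+n n))) ⟩
  dim (n ∸ u) (suc d) ℕ.+ suc u ℕ.* suc n ^ d ∎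
  where
  open ℕ.≤-Reasoning
  regroup : ∀ a u x → a ℕ.+ u ℕ.* x ℕ.+ x ≡ a ℕ.+ (1 ℕ.+ u) ℕ.* x
  regroup = solve-∀ℕ

^-distribʳ-* : ∀ a b n → (a ℕ.* b) ^ n ≡ a ^ n ℕ.* b ^ n
^-distribʳ-* a b zero    = refl
^-distribʳ-* a b (suc n) = trans (cong (a ℕ.* b ℕ.*_) (^-distribʳ-* a b n)) (swap a b (a ^ n) (b ^ n))
  where
  swap : ∀ a b x y → a ℕ.* b ℕ.* (x ℕ.* y) ≡ a ℕ.* x ℕ.* (b ℕ.* y)
  swap = solve-∀ℕ

n≤2^n : ∀ n → n ≤ 2 ^ n
n≤2^n zero    = z≤n
n≤2^n (suc n) = begin
  1 ℕ.+ n         ≤⟨ ℕ.+-mono-≤ (ℕ.m^n>0 2 n) (n≤2^n n) ⟩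
  2 ^ n ℕ.+ 2 ^ n ≡⟨ cong (2 ^ n ℕ.+_) (sym (ℕ.+-identityʳ _)) ⟩
  2 ^ suc n       ∎
  where open ℕ.≤-Reasoning

-- The left side consists of the two leading terms of the binomial expansion.
bernoulli : ∀ a n → a ^ suc n ℕ.+ suc n ℕ.* a ^ n ≤ suc a ^ suc n
bernoulli a zero    = ℕ.≤-reflexive (base a)
  where
  base : ∀ a → a ℕ.* 1 ℕ.+ 1 ≡ (1 ℕ.+ a) ℕ.* 1
  base = solve-∀ℕ
bernoulli a (suc n) = begin
  a ^ suc (suc n) ℕ.+ suc (suc n) ℕ.* a ^ suc n
    ≤⟨ ℕ.m≤m+n _ (suc n ℕ.* a ^ n) ⟩
  a ^ suc (suc n) ℕ.+ suc (suc n) ℕ.* a ^ suc n ℕ.+ suc n ℕ.* a ^ n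
    ≡⟨ expand a (a ^ n) n ⟩
  suc a ℕ.* (a ^ suc n ℕ.+ suc n ℕ.* a ^ n)
    ≤⟨ ℕ.*-monoʳ-≤ (suc a) (bernoulli a n) ⟩
  suc a ^ suc (suc n) ∎
  where
  open ℕ.≤-Reasoning
  expand : ∀ a x n → a ℕ.* (a ℕ.* x) ℕ.+ (2 ℕ.+ n) ℕ.* (a ℕ.* x) ℕ.+ (1 ℕ.+ n) ℕ.* x
                     ≡ (1 ℕ.+ a) ℕ.* (a ℕ.* x ℕ.+ (1 ℕ.+ n) ℕ.* x)
  expand = solve-∀ℕ

-- This is (1 - 1/q)^q ≤ 1/2, raised to the power j and cleared of denominators.
halving : ∀ q j .{{_ : NonZero q}} → 2 ^ j ℕ.* (q ∸ 1) ^ (q ℕ.* j) ≤ q ^ (q ℕ.* j)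
halving q@(suc a) j = begin
  2 ^ j ℕ.* a ^ (q ℕ.* j)   ≡⟨ cong (2 ^ j ℕ.*_) (sym (ℕ.^-*-assoc a q j)) ⟩
  2 ^ j ℕ.* (a ^ q) ^ j     ≡⟨ sym (^-distribʳ-* 2 (a ^ q) j) ⟩
  (2 ℕ.* a ^ q) ^ j         ≤⟨ ℕ.^-monoˡ-≤ j double ⟩
  (q ^ q) ^ j               ≡⟨ ℕ.^-*-assoc q q j ⟩
  q ^ (q ℕ.* j)             ∎
  where
  open ℕ.≤-Reasoning
  double : 2 ℕ.* a ^ q ≤ q ^ q
  double = begin
    a ^ q ℕ.+ (a ^ q ℕ.+ 0)     ≡⟨ cong (a ^ q ℕ.+_) (ℕ.+-identityʳ _) ⟩
    a ^ q ℕ.+ a ℕ.* a ^ a       ≤⟨ ℕ.+-monoʳ-≤ (a ^ q) (ℕ.*-monoˡ-≤ (a ^ a) (ℕ.n≤1+n a)) ⟩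
    a ^ suc a ℕ.+ suc a ℕ.* a ^ a ≤⟨ bernoulli a a ⟩
    q ^ q                     ∎

logFloor : ∀ p → 1 < p → ∀ n → 1 ≤ n → ∃ λ l → p ^ l ≤ n × n < p ^ suc l
logFloor p 1<p (suc zero)    _ = 0 , ℕ.≤-refl , subst (1 <_) (sym (ℕ.*-identityʳ p)) 1<p
logFloor p 1<p (suc (suc n)) _ with logFloor p 1<p (suc n) (s≤s z≤n)
... | l , lo , hi with suc (suc n) ℕ.<? p ^ suc l
...   | yes lt = l , ℕ.m≤n⇒m≤1+n lo , lt
...   | no ≮   = suc l , ℕ.≮⇒≥ ≮ , ℕ.≤-<-trans hi (ℕ.^-monoʳ-< p 1<p (ℕ.n<1+n (suc l)))

-- With q = p^d this is the number of polynomials that push the density of common zeros below 1/(e q^(l+2)).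
steps : ℕ → ℕ → ℕ → ℕ
steps q e l = q ℕ.* (e ℕ.+ q ℕ.* (2 ℕ.+ l))

-- Every q steps halve the density, and by x ≤ 2^x the number e + q (2 + l) of halvings brings it
-- below 1/(e q^(2+l)).
steps-suffice : ∀ q e l .{{_ : NonZero q}} →
  e ℕ.* q ^ (2 ℕ.+ l) ℕ.* (q ∸ 1) ^ steps q e l ≤ q ^ steps q e l
steps-suffice q e l = ℕ.≤-trans (ℕ.*-monoˡ-≤ ((q ∸ 1) ^ steps q e l) (begin
  e ℕ.* q ^ (2 ℕ.+ l)                 ≤⟨ ℕ.*-mono-≤ (n≤2^n e) (ℕ.^-monoˡ-≤ (2 ℕ.+ l) (n≤2^n q)) ⟩
  2 ^ e ℕ.* (2 ^ q) ^ (2 ℕ.+ l)       ≡⟨ cong (2 ^ e ℕ.*_) (ℕ.^-*-assoc 2 q (2 ℕ.+ l)) ⟩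
  2 ^ e ℕ.* 2 ^ (q ℕ.* (2 ℕ.+ l))     ≡⟨ sym (ℕ.^-distribˡ-+-* 2 e _) ⟩
  2 ^ (e ℕ.+ q ℕ.* (2 ℕ.+ l))         ∎))
  (halving q (e ℕ.+ q ℕ.* (2 ℕ.+ l)))
  where open ℕ.≤-Reasoning

-- Chosen to bound, per unit of l, the variables given up: d + 1 in each step, plus d for passing
-- from n + d variables to n.
slope : ℕ → ℕ → ℕ
slope q d = q ℕ.* (1 ℕ.+ (q ℕ.+ q)) ℕ.* suc d ℕ.+ d

steps-linear : ∀ q d e l → e ≤ l → 2 ≤ l → steps q e l ℕ.* suc d ℕ.+ d ≤ l ℕ.* slope q d
steps-linear q d e l e≤l 2≤l = begin
  q ℕ.* (e ℕ.+ q ℕ.* (2 ℕ.+ l)) ℕ.* suc d ℕ.+ d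
    ≤⟨ ℕ.+-mono-≤ (ℕ.*-monoˡ-≤ (suc d) (ℕ.*-monoʳ-≤ q
         (ℕ.+-mono-≤ e≤l (ℕ.*-monoʳ-≤ q (ℕ.+-monoˡ-≤ l 2≤l)))))
         (ℕ.m≤n*m d l {{ℕ.>-nonZero (ℕ.<-≤-trans z<s 2≤l)}}) ⟩
  q ℕ.* (l ℕ.+ q ℕ.* (l ℕ.+ l)) ℕ.* suc d ℕ.+ l ℕ.* d
    ≡⟨ factor q l d ⟩
  l ℕ.* slope q d ∎
  where
  open ℕ.≤-Reasoning
  factor : ∀ q l d → q ℕ.* (l ℕ.+ q ℕ.* (l ℕ.+ l)) ℕ.* (1 ℕ.+ d) ℕ.+ l ℕ.* d
    ≡ l ℕ.* (q ℕ.* (1 ℕ.+ (q ℕ.+ q)) ℕ.* (1 ℕ.+ d) ℕ.+ d)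
  factor = solve-∀ℕ

size⇒room : ∀ q d e l n m → e ≤ l → 2 ≤ l → d ≤ n →
  l ℕ.* l ℕ.* (slope q d ℕ.* 2 ^ d) ℕ.* n ^ d ℕ.+ m ≤ dim (n ℕ.+ d) (suc d) →
  m ≤ dim (n ∸ steps q e l ℕ.* suc d) (suc d)
size⇒room q d e l n m e≤l 2≤l d≤n size = ℕ.+-cancelˡ-≤ X m _ (begin
  X ℕ.+ m
    ≤⟨ size ⟩
  dim (n ℕ.+ d) (suc d)
    ≤⟨ dim-∸ (t ℕ.* suc d ℕ.+ d) (n ℕ.+ d) d ⟩
  dim (n ℕ.+ d ∸ (t ℕ.* suc d ℕ.+ d)) (suc d) ℕ.+ (t ℕ.* suc d ℕ.+ d) ℕ.* (n ℕ.+ d) ^ d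
    ≤⟨ ℕ.+-mono-≤ (ℕ.≤-reflexive (cong (λ z → dim z (suc d)) shift)) lost ⟩
  dim (n ∸ t ℕ.* suc d) (suc d) ℕ.+ X
    ≡⟨ ℕ.+-comm _ X ⟩
  X ℕ.+ dim (n ∸ t ℕ.* suc d) (suc d) ∎)
  where
  open ℕ.≤-Reasoning
  t = steps q e l
  s = slope q d
  X = l ℕ.* l ℕ.* (s ℕ.* 2 ^ d) ℕ.* n ^ d
  shift : n ℕ.+ d ∸ (t ℕ.* suc d ℕ.+ d) ≡ n ∸ t ℕ.* suc d
  shift = trans (cong₂ _∸_ (ℕ.+-comm n d) (ℕ.+-comm (t ℕ.* suc d) d)) (ℕ.[m+n]∸[m+o]≡n∸o d n _)
  regroup : ∀ l s x y → l ℕ.* (l ℕ.* s) ℕ.* (x ℕ.* y) ≡ l ℕ.* l ℕ.* (s ℕ.* x) ℕ.* y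
  regroup = solve-∀ℕ
  lost : (t ℕ.* suc d ℕ.+ d) ℕ.* (n ℕ.+ d) ^ d ≤ X
  lost = begin
    (t ℕ.* suc d ℕ.+ d) ℕ.* (n ℕ.+ d) ^ d
      -- A further factor l ≥ 1 matches the square of the logarithm.
      ≤⟨ ℕ.*-mono-≤ (ℕ.≤-trans (steps-linear q d e l e≤l 2≤l)
           (ℕ.m≤n*m (l ℕ.* s) l {{ℕ.>-nonZero (ℕ.<-≤-trans z<s 2≤l)}}))
           (ℕ.^-monoˡ-≤ d (ℕ.≤-trans (ℕ.+-monoʳ-≤ n d≤n) (ℕ.≤-reflexive (cong (n ℕ.+_) (sym (ℕ.+-identityʳ n)))))) ⟩
    l ℕ.* (l ℕ.* s) ℕ.* (2 ℕ.* n) ^ d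
      ≡⟨ cong (l ℕ.* (l ℕ.* s) ℕ.*_) (^-distribʳ-* 2 n d) ⟩
    l ℕ.* (l ℕ.* s) ℕ.* (2 ^ d ℕ.* n ^ d)
      ≡⟨ regroup l s (2 ^ d) (n ^ d) ⟩
    X ∎

-- Yields the bound on the number of points for the union bound, from n + d ≤ 2n ≤ p^(l+2).
dim-bound : ∀ p d n l → 2 ≤ p → d ≤ n → n < p ^ suc l →
  dim (n ℕ.+ d) (suc d) ≤ (p ^ suc d) ^ (2 ℕ.+ l)
dim-bound p d n l 2≤p d≤n n< = begin
  dim (n ℕ.+ d) (suc d)          ≤⟨ dim≤^ (n ℕ.+ d) (suc d) ⟩
  (n ℕ.+ d) ^ suc d              ≤⟨ ℕ.^-monoˡ-≤ (suc d) n+d≤ ⟩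
  (p ^ (2 ℕ.+ l)) ^ suc d        ≡⟨ ℕ.^-*-assoc p (2 ℕ.+ l) (suc d) ⟩
  p ^ ((2 ℕ.+ l) ℕ.* suc d)      ≡⟨ cong (p ^_) (ℕ.*-comm (2 ℕ.+ l) (suc d)) ⟩
  p ^ (suc d ℕ.* (2 ℕ.+ l))      ≡⟨ sym (ℕ.^-*-assoc p (suc d) (2 ℕ.+ l)) ⟩
  (p ^ suc d) ^ (2 ℕ.+ l)        ∎
  where
  open ℕ.≤-Reasoning
  n+d≤ : n ℕ.+ d ≤ p ^ (2 ℕ.+ l)
  n+d≤ = begin
    n ℕ.+ d         ≤⟨ ℕ.+-monoʳ-≤ n d≤n ⟩
    n ℕ.+ n         ≡⟨ cong (n ℕ.+_) (sym (ℕ.+-identityʳ n)) ⟩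
    2 ℕ.* n         ≤⟨ ℕ.*-mono-≤ 2≤p (ℕ.<⇒≤ n<) ⟩
    p ℕ.* p ^ suc l ∎

-- The hypothesis reads ℓ/X ≥ 1 - m/(eM), and m ≤ M makes the loss at most 1/e.
success-fraction : ∀ e M m X ℓ .{{_ : NonZero M}} → m ≤ M →
  e ℕ.* M ℕ.* X ≤ e ℕ.* M ℕ.* ℓ ℕ.+ m ℕ.* X → (e ∸ 1) ℕ.* X ≤ e ℕ.* ℓ
success-fraction e M m X ℓ m≤M h = begin
  (e ∸ 1) ℕ.* X         ≡⟨ ℕ.*-distribʳ-∸ X e 1 ⟩
  e ℕ.* X ∸ 1 ℕ.* X     ≤⟨ ℕ.m≤n+o⇒m∸n≤o (e ℕ.* X) (1 ℕ.* X) cancelled ⟩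
  e ℕ.* ℓ               ∎
  where
  open ℕ.≤-Reasoning
  regroup : ∀ e M X → M ℕ.* (e ℕ.* X) ≡ e ℕ.* M ℕ.* X
  regroup = solve-∀ℕ
  collect : ∀ e M X ℓ → e ℕ.* M ℕ.* ℓ ℕ.+ M ℕ.* X ≡ M ℕ.* (1 ℕ.* X ℕ.+ e ℕ.* ℓ)
  collect = solve-∀ℕ
  cancelled : e ℕ.* X ≤ 1 ℕ.* X ℕ.+ e ℕ.* ℓ
  cancelled = ℕ.*-cancelˡ-≤ M (begin
    M ℕ.* (e ℕ.* X)                     ≡⟨ regroup e M X ⟩
    e ℕ.* M ℕ.* X                       ≤⟨ h ⟩
    e ℕ.* M ℕ.* ℓ ℕ.+ m ℕ.* X           ≤⟨ ℕ.+-monoʳ-≤ (e ℕ.* M ℕ.* ℓ) (ℕ.*-monoˡ-≤ X m≤M) ⟩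
    e ℕ.* M ℕ.* ℓ ℕ.+ M ℕ.* X           ≡⟨ collect e M X ℓ ⟩
    M ℕ.* (1 ℕ.* X ℕ.+ e ℕ.* ℓ)         ∎)

-- Linear algebra modulo p

module ModPrime (p : ℕ) (p-prime : Prime p) where

  infix 4 p∣_
  -- Stands for being zero in the field: computations stay in ℤ, where ring identities are
  -- available, and only zero tests are taken modulo p.
  p∣_ : ℤ → Set
  p∣ z = + p ∣ z

  p∣? : ∀ z → Dec (p∣ z)
  p∣? z = + p ∣? z

  euclid : ∀ {a b} → ¬ p∣ a → ¬ p∣ b → ¬ p∣ a * b
  euclid {a} {b} ¬a ¬b p∣ab
    with euclidsLemma ∣ a ∣ ∣ b ∣ p-prime (subst (p ℕ.∣_) (ℤ.abs-* a b) (∣⇒∣ᵤ p∣ab))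
  ... | inj₁ p∣a = ¬a (∣ᵤ⇒∣ p∣a)
  ... | inj₂ p∣b = ¬b (∣ᵤ⇒∣ p∣b)

  1<p : 1 < p
  1<p = ℕ.nonTrivial⇒n>1 p {{prime⇒nonTrivial p-prime}}

  ¬p∣1 : ¬ p∣ 1ℤ
  ¬p∣1 p∣1 = ℕ.<⇒≱ 1<p (ℕ.∣⇒≤ (∣⇒∣ᵤ p∣1))

  p∣0 : p∣ 0ℤ
  p∣0 = divides 0ℤ refl

  -- The last argument of `found` replaces a permutation of the rows: what holds for the pivot row
  -- and the rest holds for all rows.
  data Pivot {D} : ∀ {i} → Vec (Vec ℤ (suc D)) i → Set₁ where
    none  : ∀ {i} {rows : Vec _ i} → VAll (λ r → p∣ head r) rows → Pivot rows
    found : ∀ {i} {rows : Vec _ (suc i)} row (rest : Vec _ i) → ¬ p∣ head row →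
            ({P : Vec ℤ (suc D) → Set} → P row → VAll P rest → VAll P rows) → Pivot rows

  pivot : ∀ {D i} (rows : Vec (Vec ℤ (suc D)) i) → Pivot rows
  pivot []         = none []
  pivot (r ∷ rows) with p∣? (head r)
  ... | no ¬p∣r = found r rows ¬p∣r _∷_
  ... | yes p∣r with pivot rows
  ...   | none p∣rows              = none (p∣r ∷ p∣rows)
  ...   | found row rest ¬p∣row ok =
    found row (r ∷ rest) ¬p∣row λ { Prow (Pr ∷ Prest) → Pr ∷ ok Prow Prest }

  -- Fraction-free elimination: scaling by the pivot instead of dividing by it keeps everything in ℤ.
  kernel : ∀ {D i} → i < D → (rows : Vec (Vec ℤ D) i) →
    Σ (Vec ℤ D) λ c → VAny (λ z → ¬ p∣ z) c × VAll (λ r → p∣ dot r c) rows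
  kernel {suc D} i<D rows with pivot rows
  -- The first coordinate is unconstrained, so the first unit vector is a solution.
  ... | none p∣heads = 1ℤ ∷ Vec.replicate D 0ℤ , here ¬p∣1 , VAll.map (λ {r} → annihilates r) p∣heads
    where
    annihilates : ∀ r → p∣ head r → p∣ dot r (1ℤ ∷ Vec.replicate D 0ℤ)
    annihilates (x ∷ r) p∣x = subst p∣_
      (sym (trans (cong₂ _+_ (ℤ.*-identityʳ x) (dot-zeroʳ r)) (ℤ.+-identityʳ x))) p∣x
  kernel {suc D} i<D rows | found (a ∷ u) rest ¬p∣a ok
    with kernel (s≤s⁻¹ i<D) (Vec.map (eliminate a u) rest)
  ... | c , c≢0 , p∣rest =
    -- This first entry cancels the pivot row exactly and turns every other row into its eliminated
    -- form applied to `c`.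
    (- dot u c) ∷ Vec.map (a *_) c ,
    there (VAny.map⁺ (VAny.map (euclid ¬p∣a) c≢0)) ,
    ok (subst p∣_ (sym pivot-row) p∣0) (VAll.map (λ {r} → other-row r) (VAll.map⁻ p∣rest))
    where
    dot-scaleʳ : ∀ v → dot v (Vec.map (a *_) c) ≡ a * dot v c
    dot-scaleʳ v = trans (dot-comm v _) (trans (dot-scaleˡ a c v) (cong (a *_) (dot-comm c v)))
    pivot-row : a * (- dot u c) + dot u (Vec.map (a *_) c) ≡ 0ℤ
    pivot-row = trans (cong (λ s → a * (- dot u c) + s) (dot-scaleʳ u)) (cancel a (dot u c))
      where
      cancel : ∀ a s → a * (- s) + a * s ≡ 0ℤ
      cancel = solve-∀
    other-row : ∀ r → p∣ dot (eliminate a u r) c → p∣ dot r ((- dot u c) ∷ Vec.map (a *_) c)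
    other-row (b ∷ v) h = subst p∣_
      (trans (dot-combine a b v u c)
        (trans (rearrange a b (dot v c) (dot u c)) (cong (λ s → b * (- dot u c) + s) (sym (dot-scaleʳ v))))) h
      where
      rearrange : ∀ a b s t → a * s - b * t ≡ b * (- t) + a * s
      rearrange = solve-∀

  -- Nonzero as a formal expression: a path of `left` and `right` leads to a coefficient prime to p.
  data NonZeroP : ∀ {n d} → Poly n d → Set where
    con   : ∀ {n c} → ¬ p∣ c → NonZeroP (con {n} c)
    left  : ∀ {n d} {q : Poly n (suc d)} {r} → NonZeroP q → NonZeroP (q ∙ r)
    right : ∀ {n d} {q : Poly n (suc d)} {r} → NonZeroP r → NonZeroP (q ∙ r)

  vanishes⊎nonZero : ∀ {n d} (q : Poly n d) → (∀ x → p∣ eval q x) ⊎ NonZeroP q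
  vanishes⊎nonZero (con c) with p∣? c
  ... | yes p∣c = inj₁ (λ _ → p∣c)
  ... | no ¬p∣c = inj₂ (con ¬p∣c)
  vanishes⊎nonZero nil = inj₁ (λ _ → p∣0)
  vanishes⊎nonZero (q ∙ r) with vanishes⊎nonZero q | vanishes⊎nonZero r
  ... | inj₂ q≢0 | _        = inj₂ (left q≢0)
  ... | inj₁ _   | inj₂ r≢0 = inj₂ (right r≢0)
  ... | inj₁ q≡0 | inj₁ r≡0 = inj₁ λ { (x ∷ xs) → ∣m∣n⇒∣m+n (q≡0 xs) (∣n⇒∣m*n x (r≡0 xs)) }

  fromCoeffs-nonZero : ∀ n d (c : Vec ℤ (dim n d)) → VAny (λ z → ¬ p∣ z) c → NonZeroP (fromCoeffs n d c)
  fromCoeffs-nonZero n       zero    (c ∷ []) (here ¬p∣c) = con ¬p∣c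
  fromCoeffs-nonZero zero    (suc d) []       ()
  fromCoeffs-nonZero (suc n) (suc d) c        c≢0
    with VAny.++⁻ (take (dim n (suc d)) c)
           (subst (VAny (λ z → ¬ p∣ z)) (sym (take++drop≡id (dim n (suc d)) c)) c≢0)
  ... | inj₁ h = left (fromCoeffs-nonZero n (suc d) _ h)
  ... | inj₂ h = right (fromCoeffs-nonZero n d _ h)

  -- Points of the space and counting

  V : ℕ → Set
  V = Vec (Fin p)

  ⟦_⟧ : ∀ {n} → V n → Vec ℤ n
  ⟦_⟧ = Vec.map (λ a → + toℕ a)

  points : ∀ n → List (V n)
  points zero    = [] ∷ []
  points (suc n) = cartesianProductWith _∷_ (allFin p) (points n)

  Σ-points-const : ∀ n c → Σ[ points n ] (λ _ → c) ≡ p ^ n ℕ.* c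
  Σ-points-const zero    c = refl
  Σ-points-const (suc n) c = begin
    Σ[ points (suc n) ] (λ _ → c)
      ≡⟨ Σ-cartesian _∷_ (allFin p) (points n) _ ⟩
    Σ[ allFin p ] (λ _ → Σ[ points n ] (λ _ → c))
      ≡⟨ Σ-cong (allFin p) (λ _ → Σ-points-const n c) ⟩
    Σ[ allFin p ] (λ _ → p ^ n ℕ.* c)
      ≡⟨ Σ-const (allFin p) _ ⟩
    length (allFin p) ℕ.* (p ^ n ℕ.* c)
      ≡⟨ cong (ℕ._* (p ^ n ℕ.* c)) (length-tabulate {n = p} id) ⟩
    p ℕ.* (p ^ n ℕ.* c)
      ≡⟨ sym (ℕ.*-assoc p (p ^ n) c) ⟩
    p ^ suc n ℕ.* c ∎
    where open ≡-Reasoning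

  count : ∀ {n} → (V n → Bool) → ℕ
  count {n} f = Σ[ points n ] (𝟙 ∘ f)

  vanishes : ∀ {n d} → Poly n d → V n → Bool
  vanishes q x = does (p∣? (eval q ⟦ x ⟧))

  nonvanishing⁺ : ∀ {n d} (q : Poly n d) x → ¬ p∣ eval q ⟦ x ⟧ → T (not (vanishes q x))
  nonvanishing⁺ q x = T-not-does⁺ (p∣? (eval q ⟦ x ⟧))

  nonvanishing⁻ : ∀ {n d} (q : Poly n d) x → T (not (vanishes q x)) → ¬ p∣ eval q ⟦ x ⟧
  nonvanishing⁻ q x = T-not-does⁻ (p∣? (eval q ⟦ x ⟧))

  -- Every choice of the r surviving coordinates extends to a point where q is nonzero. The
  -- inequality for all `G` expresses this without an explicit injection and passes through the
  -- recursion.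
  Liftable : ∀ {n d} → Poly n d → Set
  Liftable {n} {d} q = Σ ℕ λ r → Σ (Sel n d r) λ s → (G : V r → Bool) →
    count G ≤ count (λ x → not (vanishes q x) ∧ G (delete s x))

  -- Where r is nonzero, the values of q + x₀ r at x₀ = 0 and x₀ = 1 differ by r, so one of them is
  -- nonzero.
  liftable-pick : ∀ {n d} (q : Poly n (suc d)) (r : Poly n d) → Liftable r → Liftable (q ∙ r)
  liftable-pick {n} q r (m , s , bound) = m , pick s , λ G → begin
    count G
      ≤⟨ bound G ⟩
    Σ[ points n ] (λ x → 𝟙 (not (vanishes r x) ∧ G (delete s x)))
      ≤⟨ Σ-mono (points n) (λ x → 𝟙-union _ (H G b₀ x) (H G b₁ x) (two-values G x)) ⟩
    Σ[ points n ] (λ x → 𝟙 (H G b₀ x) ℕ.+ 𝟙 (H G b₁ x))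
      ≡⟨ Σ-+ (points n) _ _ ⟩
    Σ[ points n ] (λ x → 𝟙 (H G b₀ x)) ℕ.+ Σ[ points n ] (λ x → 𝟙 (H G b₁ x))
      ≤⟨ b₀+b₁≤ (λ a → Σ[ points n ] (λ x → 𝟙 (H G a x))) ⟩
    Σ[ allFin p ] (λ a → Σ[ points n ] (λ x → 𝟙 (H G a x)))
      ≡⟨ sym (Σ-cartesian _∷_ (allFin p) (points n) _) ⟩
    count (λ x → not (vanishes (q ∙ r) x) ∧ G (delete (pick s) x)) ∎
    where
    open ℕ.≤-Reasoning
    open Bits (bits p 1<p)
    H : (V m → Bool) → Fin p → V n → Bool
    H G a x = not (vanishes (q ∙ r) (a ∷ x)) ∧ G (delete s x)
    difference : ∀ u v → (u + 1ℤ * v) - (u + 0ℤ * v) ≡ v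
    difference = solve-∀
    two-values : ∀ G x → T (not (vanishes r x) ∧ G (delete s x)) → T (H G b₀ x) ⊎ T (H G b₁ x)
    two-values G x t with T-∧⁻ {not (vanishes r x)} t
    ... | r≢0 , g with p∣? (eval (q ∙ r) ⟦ b₀ ∷ x ⟧) | p∣? (eval (q ∙ r) ⟦ b₁ ∷ x ⟧)
    ...   | no ¬z₀ | _      = inj₁ (T-∧⁺ (nonvanishing⁺ (q ∙ r) (b₀ ∷ x) ¬z₀) g)
    ...   | yes _  | no ¬z₁ = inj₂ (T-∧⁺ (nonvanishing⁺ (q ∙ r) (b₁ ∷ x) ¬z₁) g)
    ...   | yes z₀ | yes z₁ = ⊥-elim (nonvanishing⁻ r x r≢0
      (subst p∣_
        (trans (cong₂ (λ i j → (eval q ⟦ x ⟧ + + j * eval r ⟦ x ⟧) - (eval q ⟦ x ⟧ + + i * eval r ⟦ x ⟧))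
                      toℕ-b₀ toℕ-b₁)
               (difference (eval q ⟦ x ⟧) (eval r ⟦ x ⟧)))
        (∣m∣n⇒∣m-n z₁ z₀)))

  -- As r vanishes, q + x₀ r agrees with q modulo p for each x₀; the variable is kept and the bound
  -- for q is summed over its values.
  liftable-skip : ∀ {n d} (q : Poly n (suc d)) (r : Poly n d) →
    (∀ x → p∣ eval r x) → Liftable q → Liftable (q ∙ r)
  liftable-skip {n} q r r≡0 (m , s , bound) = suc m , skip s , λ G → begin
    count G
      ≡⟨ Σ-cartesian _∷_ (allFin p) (points m) _ ⟩
    Σ[ allFin p ] (λ a → count (λ y → G (a ∷ y)))
      ≤⟨ Σ-mono (allFin p) (λ a → ℕ.≤-trans (bound (λ y → G (a ∷ y)))
           (Σ-mono (points n) (λ x → 𝟙-mono (not (vanishes q x) ∧ G (a ∷ delete s x)) _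
             (λ t → let q≢0 , g = T-∧⁻ {not (vanishes q x)} t in
               T-∧⁺ (nonvanishing⁺ (q ∙ r) (a ∷ x) (still-nonzero a x (nonvanishing⁻ q x q≢0))) g)))) ⟩
    Σ[ allFin p ] (λ a → Σ[ points n ] (λ x →
        𝟙 (not (vanishes (q ∙ r) (a ∷ x)) ∧ G (a ∷ delete s x))))
      ≡⟨ sym (Σ-cartesian _∷_ (allFin p) (points n) _) ⟩
    count (λ x → not (vanishes (q ∙ r) x) ∧ G (delete (skip s) x)) ∎
    where
    open ℕ.≤-Reasoning
    still-nonzero : ∀ a x → ¬ p∣ eval q ⟦ x ⟧ → ¬ p∣ eval (q ∙ r) ⟦ a ∷ x ⟧
    still-nonzero a x ¬z z = ¬z (∣m+n∣n⇒∣m z (∣n⇒∣m*n (+ toℕ a) (r≡0 ⟦ x ⟧)))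

  nonZero⇒liftable : ∀ {n d} (q : Poly n d) → NonZeroP q → Liftable q
  nonZero⇒liftable {n} (con c) (con ¬p∣c) = n , done , λ G → Σ-mono (points n)
    λ x → 𝟙-mono (G x) _ (T-∧⁺ (nonvanishing⁺ (con c) x ¬p∣c))
  nonZero⇒liftable (q ∙ r) q∙r≢0 with vanishes⊎nonZero r | q∙r≢0
  -- A variable may be skipped only when r vanishes identically, so r is examined first.
  ... | inj₂ r≢0 | _         = liftable-pick q r (nonZero⇒liftable r r≢0)
  ... | inj₁ _   | right r≢0 = liftable-pick q r (nonZero⇒liftable r r≢0)
  ... | inj₁ r≡0 | left q≢0  = liftable-skip q r r≡0 (nonZero⇒liftable q q≢0)

  -- Each point has p^e preimages under the deletion of e coordinates.
  Σ-delete : ∀ {n e r} (s : Sel n e r) (f : V r → ℕ) →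
    Σ[ points n ] (f ∘ delete s) ≡ p ^ e ℕ.* Σ[ points r ] f
  Σ-delete done f = sym (ℕ.+-identityʳ _)
  Σ-delete {suc n} {e} {suc r} (skip s) f = begin
    Σ[ points (suc n) ] (f ∘ delete (skip s))
      ≡⟨ Σ-cartesian _∷_ (allFin p) (points n) _ ⟩
    Σ[ allFin p ] (λ a → Σ[ points n ] (λ x → f (a ∷ delete s x)))
      ≡⟨ Σ-cong (allFin p) (λ a → Σ-delete s (λ y → f (a ∷ y))) ⟩
    Σ[ allFin p ] (λ a → p ^ e ℕ.* Σ[ points r ] (λ y → f (a ∷ y)))
      ≡⟨ Σ-* (allFin p) (p ^ e) _ ⟩
    p ^ e ℕ.* Σ[ allFin p ] (λ a → Σ[ points r ] (λ y → f (a ∷ y)))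
      ≡⟨ cong (p ^ e ℕ.*_) (sym (Σ-cartesian _∷_ (allFin p) (points r) f)) ⟩
    p ^ e ℕ.* Σ[ points (suc r) ] f ∎
    where open ≡-Reasoning
  Σ-delete {suc n} {suc e} {r} (pick s) f = begin
    Σ[ points (suc n) ] (f ∘ delete (pick s))
      ≡⟨ Σ-cartesian _∷_ (allFin p) (points n) _ ⟩
    Σ[ allFin p ] (λ _ → Σ[ points n ] (f ∘ delete s))
      ≡⟨ Σ-const (allFin p) _ ⟩
    length (allFin p) ℕ.* Σ[ points n ] (f ∘ delete s)
      ≡⟨ cong₂ ℕ._*_ (length-tabulate {n = p} id) (Σ-delete s f) ⟩
    p ℕ.* (p ^ e ℕ.* Σ[ points r ] f)
      ≡⟨ sym (ℕ.*-assoc p (p ^ e) _) ⟩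
    p ^ suc e ℕ.* Σ[ points r ] f ∎
    where open ≡-Reasoning

  -- Common zeros of the forms vanishing at given points

  allVanish : ∀ {n d} → List (Poly n d) → V n → Bool
  allVanish qs x = all (λ q → vanishes q x) qs

  eval-pullback-points : ∀ {n e r d} (s : Sel n e r) (q : Poly r d) (x : V n) →
    eval (pullback s q) ⟦ x ⟧ ≡ eval q ⟦ delete s x ⟧
  eval-pullback-points s q x =
    trans (eval-pullback s q ⟦ x ⟧) (cong (eval q) (sym (map-delete _ s x)))

  allVanish-pullback : ∀ {n e r d} (s : Sel n e r) (qs : List (Poly r d)) x →
    allVanish (List.map (pullback s) qs) x ≡ allVanish qs (delete s x)
  allVanish-pullback s []       x = refl
  allVanish-pullback s (q ∷ qs) x =
    cong₂ _∧_ (cong (λ z → does (p∣? z)) (eval-pullback-points s q x)) (allVanish-pullback s qs x)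

  VanishesOn : ∀ {n d i} → Vec (V n) i → Poly n d → Set
  VanishesOn ss q = VAll (λ x → p∣ eval q ⟦ x ⟧) ss

  -- Vanishing at a point is one linear condition on the coefficients, and there are fewer
  -- conditions than coefficients.
  interpolate : ∀ {n d i} (ss : Vec (V n) i) → i < dim n d →
    Σ (Poly n d) λ q → NonZeroP q × VanishesOn ss q
  interpolate {n} {d} ss i<dim with kernel i<dim (Vec.map (monomials d ∘ ⟦_⟧) ss)
  ... | c , c≢0 , p∣rows = fromCoeffs n d c , fromCoeffs-nonZero n d c c≢0 ,
    VAll.map (λ {x} → subst p∣_ (sym (eval-fromCoeffs n d c ⟦ x ⟧))) (VAll.map⁻ p∣rows)

  -- Once q is found, the d variables of one of its monomials are deleted and the induction runs on
  -- the projected points. Over each common zero of the later forms lie p^d points, at least one of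
  -- them not a zero of q, so each step contributes a factor 1 - p^-d.
  fewCommonZeros : ∀ d t {n i} (ss : Vec (V n) i) → i < dim (n ∸ t ℕ.* d) d →
    Σ (List (Poly n d)) λ qs → All (VanishesOn ss) qs ×
      count (allVanish qs) ℕ.* (p ^ d) ^ t ≤ (p ^ d ∸ 1) ^ t ℕ.* p ^ n
  fewCommonZeros d zero {n} ss _ = [] , [] , ℕ.≤-reflexive
    (trans (ℕ.*-identityʳ _) (trans (Σ-points-const n 1)
      (trans (ℕ.*-identityʳ _) (sym (ℕ.+-identityʳ _)))))
  fewCommonZeros d (suc t) {n} {i} ss i<dim
    with interpolate ss (ℕ.<-≤-trans i<dim (dim-mono d (ℕ.m∸n≤m n (d ℕ.+ t ℕ.* d))))
  ... | q , q≢0 , q-van with nonZero⇒liftable q q≢0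
  ...   | r , s , bound
    with fewCommonZeros d t {r} (Vec.map (delete s) ss)
           (subst (λ m → i < dim m d) remaining i<dim)
    where
    remaining : n ∸ (d ℕ.+ t ℕ.* d) ≡ r ∸ t ℕ.* d
    remaining = trans (sym (ℕ.∸-+-assoc n d (t ℕ.* d)))
      (cong (_∸ t ℕ.* d) (trans (cong (_∸ d) (Sel-size s)) (ℕ.m+n∸m≡n d r)))
  ...     | qs , qs-van , few =
    q ∷ List.map (pullback s) qs ,
    q-van ∷ All.map⁺ (All.map (λ {q′} h →
      VAll.map (λ {x} → subst p∣_ (sym (eval-pullback-points s q′ x))) (VAll.map⁻ h)) qs-van) ,
    (begin
      count (allVanish (q ∷ List.map (pullback s) qs)) ℕ.* (Q ℕ.* Q ^ t)
        ≤⟨ ℕ.*-monoˡ-≤ (Q ℕ.* Q ^ t) bad≤ ⟩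
      (Q ∸ 1) ℕ.* g ℕ.* (Q ℕ.* Q ^ t)
        ≡⟨ regroup (Q ∸ 1) g Q (Q ^ t) ⟩
      (Q ∸ 1) ℕ.* Q ℕ.* (g ℕ.* Q ^ t)
        ≤⟨ ℕ.*-monoʳ-≤ ((Q ∸ 1) ℕ.* Q) few ⟩
      (Q ∸ 1) ℕ.* Q ℕ.* ((Q ∸ 1) ^ t ℕ.* p ^ r)
        ≡⟨ regroup′ (Q ∸ 1) Q ((Q ∸ 1) ^ t) (p ^ r) ⟩
      (Q ∸ 1) ^ suc t ℕ.* (p ^ d ℕ.* p ^ r)
        ≡⟨ cong ((Q ∸ 1) ^ suc t ℕ.*_) (trans (sym (ℕ.^-distribˡ-+-* p d r)) (cong (p ^_) (sym (Sel-size s)))) ⟩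
      (Q ∸ 1) ^ suc t ℕ.* p ^ n ∎)
    where
    open ℕ.≤-Reasoning
    Q = p ^ d
    G = allVanish qs
    g = count G
    bad = count (allVanish (q ∷ List.map (pullback s) qs))
    regroup : ∀ a g b c → a ℕ.* g ℕ.* (b ℕ.* c) ≡ a ℕ.* b ℕ.* (g ℕ.* c)
    regroup = solve-∀ℕ
    regroup′ : ∀ a b c e → a ℕ.* b ℕ.* (c ℕ.* e) ≡ a ℕ.* c ℕ.* (b ℕ.* e)
    regroup′ = solve-∀ℕ
    bad+g≤ : bad ℕ.+ g ≤ Q ℕ.* g
    bad+g≤ = begin
      bad ℕ.+ g
        ≤⟨ ℕ.+-mono-≤ (ℕ.≤-reflexive (Σ-cong (points n)
             (λ x → cong (λ b → 𝟙 (vanishes q x ∧ b)) (allVanish-pullback s qs x)))) (bound G) ⟩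
      count (λ x → vanishes q x ∧ G (delete s x)) ℕ.+ count (λ x → not (vanishes q x) ∧ G (delete s x))
        ≡⟨ sym (Σ-+ (points n) _ _) ⟩
      Σ[ points n ] (λ x → 𝟙 (vanishes q x ∧ G (delete s x)) ℕ.+ 𝟙 (not (vanishes q x) ∧ G (delete s x)))
        ≡⟨ Σ-cong (points n) (λ x → 𝟙-split (vanishes q x) (G (delete s x))) ⟩
      Σ[ points n ] (𝟙 ∘ G ∘ delete s)
        ≡⟨ Σ-delete s (𝟙 ∘ G) ⟩
      Q ℕ.* g ∎
    bad≤ : bad ≤ (Q ∸ 1) ℕ.* g
    bad≤ = begin
      bad              ≤⟨ ℕ.m+n≤o⇒m≤o∸n bad bad+g≤ ⟩
      Q ℕ.* g ∸ g       ≡⟨ cong (Q ℕ.* g ∸_) (sym (ℕ.*-identityˡ g)) ⟩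
      Q ℕ.* g ∸ 1 ℕ.* g ≡⟨ sym (ℕ.*-distribʳ-∸ g Q 1) ⟩
      (Q ∸ 1) ℕ.* g     ∎

  points-unique : ∀ n → Unique (points n)
  points-unique zero    = [] ∷ []
  points-unique (suc n) =
    Unique.cartesianProductWith⁺ _∷_ ∷-injective (Unique.allFin⁺ p) (points-unique n)

  length-points : ∀ n → length (points n) ≡ p ^ n
  length-points n = trans (sym (trans (Σ-const (points n) 1) (ℕ.*-identityʳ _)))
    (trans (Σ-points-const n 1) (ℕ.*-identityʳ _))

  -- Level sets without progressions

  module _ .{{p≢0 : NonZero p}} where

    p∣-%ℕ : ∀ z → p∣ z - + (z %ℕ p)
    p∣-%ℕ z = divides (z /ℕ p) (trans (cong (_- + (z %ℕ p)) (a≡a%ℕn+[a/ℕn]*n z p))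
      (cancel (+ (z %ℕ p)) ((z /ℕ p) * + p)))
      where
      cancel : ∀ a b → a + b - a ≡ b
      cancel = solve-∀

    p∣-mod : ∀ m → p∣ + m - + toℕ (m mod p)
    p∣-mod m = divides (+ (m ℕ./ p)) (begin
      + m - + toℕ (m mod p)
        ≡⟨ cong₂ (λ a b → + a - + b) (m≡m%n+[m/n]*n m p) (Fin.toℕ-fromℕ< (m%n<n m p)) ⟩
      + (m ℕ.% p ℕ.+ m ℕ./ p ℕ.* p) - + (m ℕ.% p)
        ≡⟨ cong (_- + (m ℕ.% p)) (trans (ℤ.pos-+ (m ℕ.% p) _)
             (cong (λ z → + (m ℕ.% p) + z) (ℤ.pos-* (m ℕ./ p) p))) ⟩
      + (m ℕ.% p) + + (m ℕ./ p) * + p - + (m ℕ.% p)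
        ≡⟨ cancel (+ (m ℕ.% p)) _ ⟩
      + (m ℕ./ p) * + p ∎)
      where
      open ≡-Reasoning
      cancel : ∀ a b → a + b - a ≡ b
      cancel = solve-∀

    -- Differences are taken along the integer line, whereas `apTerm` reduces each coordinate modulo
    -- p; forms respect this congruence.
    eval-apTerm : ∀ {n d} (q : Poly n d) (x y : 𝔽^ p n) j →
      p∣ eval q (lineV ⟦ x ⟧ ⟦ y ⟧ j) - eval q ⟦ apTerm x y j ⟧
    eval-apTerm (con c) x y j = subst p∣_ (sym (ℤ.+-inverseʳ c)) (p∣0)
    eval-apTerm nil [] [] j = p∣0
    eval-apTerm (q ∙ r) (a ∷ x) (b ∷ y) j = subst p∣_
      (sym (split (eval q (lineV ⟦ x ⟧ ⟦ y ⟧ j)) (eval q ⟦ apTerm x y j ⟧) l l′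
                  (eval r (lineV ⟦ x ⟧ ⟦ y ⟧ j)) (eval r ⟦ apTerm x y j ⟧)))
      (∣m∣n⇒∣m+n (eval-apTerm q x y j)
        (∣m∣n⇒∣m+n (∣n⇒∣m*n l (eval-apTerm r x y j))
          (∣m⇒∣m*n (eval r ⟦ apTerm x y j ⟧) (subst (λ z → p∣ z - l′) as-line (p∣-mod (toℕ a ℕ.+ j ℕ.* toℕ b))))))
      where
      l  = line (+ toℕ a) (+ toℕ b) j
      l′ = + toℕ ((toℕ a ℕ.+ j ℕ.* toℕ b) mod p)
      as-line : + (toℕ a ℕ.+ j ℕ.* toℕ b) ≡ line (+ toℕ a) (+ toℕ b) j
      as-line = trans (ℤ.pos-+ (toℕ a) _) (cong (λ z → + toℕ a + z) (ℤ.pos-* j (toℕ b)))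
      split : ∀ u u′ l l′ w w′ → (u + l * w) - (u′ + l′ * w′) ≡ (u - u′) + (l * (w - w′) + (l - l′) * w′)
      split = solve-∀

    -- A difference of positive order kills the constant v, and order m + 1 at i involves only the
    -- values at i, ..., i + m + 1.
    p∣Δ^ : ∀ m h v i → (∀ j → j ≤ suc m ℕ.+ i → p∣ h j - v) → p∣ Δ^ (suc m) h i
    p∣Δ^ zero h v i h≡v = subst p∣_ (cancel (h (suc i)) (h i) v)
      (∣m∣n⇒∣m-n (h≡v (suc i) ℕ.≤-refl) (h≡v i (ℕ.n≤1+n i)))
      where
      cancel : ∀ a b v → (a - v) - (b - v) ≡ a - b
      cancel = solve-∀
    p∣Δ^ (suc m) h v i h≡v = ∣m∣n⇒∣m-n
      (p∣Δ^ m h v (suc i) (λ j j≤ → h≡v j (subst (j ≤_) (cong suc (ℕ.+-suc m i)) j≤)))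
      (p∣Δ^ m h v i (λ j j≤ → h≡v j (ℕ.m≤n⇒m≤1+n j≤)))

    ¬p∣! : ∀ d → d < p → ¬ p∣ + (d !)
    ¬p∣! zero    _   = ¬p∣1
    ¬p∣! (suc d) d<p = subst (λ z → ¬ p∣ z) (sym (ℤ.pos-* (suc d) (d !)))
      (euclid {+ suc d} {+ (d !)} (λ h → ℕ.<⇒≱ d<p (ℕ.∣⇒≤ (∣⇒∣ᵤ h))) (¬p∣! d (ℕ.<-trans (ℕ.n<1+n d) d<p)))

    residue : ℤ → Fin p
    residue z = fromℕ< (n%ℕd<d z p)

    p∣-residue : ∀ z → p∣ z - + toℕ (residue z)
    p∣-residue z = subst (λ r → p∣ z - + r) (sym (Fin.toℕ-fromℕ< (n%ℕd<d z p))) (p∣-%ℕ z)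

    -- On the level set {q = v} the d-th difference of q along a (d + 1)-term progression is 0,
    -- but it equals d! q(y).
    nonvanishing⇒good : ∀ {d n m} (s : Vec (V n) m) (q : Poly n (suc d)) → suc d < p →
      VAll (λ x → ¬ p∣ eval q ⟦ x ⟧) s → Good p (suc (suc d)) p n m s
    nonvanishing⇒good {d} {n} s q d<p q≢0
      with pigeonhole (λ x → residue (eval q ⟦ x ⟧)) (0 mod p) (points n)
    ... | v , dense = level , Unique.filter⁺ level? (points-unique n) ,
      subst (_≤ p ℕ.* length level) (length-points n) dense , no-AP
      where
      level? = λ x → residue (eval q ⟦ x ⟧) Fin.≟ v
      level = filter level? (points n)
      no-AP : NoAPdiffIn p (suc (suc d)) n _ level s
      no-AP x y (i , refl) _ ap = euclid (¬p∣! (suc d) d<p) (VAll.lookup⁺ q≢0 i)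
        (subst p∣_ (Δ^-eval q ⟦ x ⟧ ⟦ y ⟧ 0) (p∣Δ^ d _ (+ toℕ v) 0 constant))
        where
        constant : ∀ j → j ≤ suc d ℕ.+ 0 → p∣ eval q (lineV ⟦ x ⟧ ⟦ y ⟧ j) - + toℕ v
        constant j j≤ = subst p∣_ (telescope (eval q (lineV ⟦ x ⟧ ⟦ y ⟧ j)) (eval q ⟦ apTerm x y j ⟧) (+ toℕ v))
          (∣m∣n⇒∣m+n (eval-apTerm q x y j)
            (subst (λ w → p∣ eval q ⟦ apTerm x y j ⟧ - + toℕ w) in-level (p∣-residue (eval q ⟦ apTerm x y j ⟧))))
          where
          -- A difference of order d + 1 takes d + 2 values, exactly the number of terms of the
          -- progression.
          j< : j < suc (suc d)
          j< = s≤s (subst (j ≤_) (ℕ.+-identityʳ (suc d)) j≤)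
          in-level : residue (eval q ⟦ apTerm x y j ⟧) ≡ v
          in-level = subst (λ i → residue (eval q ⟦ apTerm x y i ⟧) ≡ v) (Fin.toℕ-fromℕ< j<)
            (proj₂ (∈-filter⁻ level? {xs = points n} (ap (fromℕ< j<))))
          telescope : ∀ a b c → (a - b) + (b - c) ≡ a - c
          telescope = solve-∀

  -- Adding the random points one at a time

  Nonvanishing : ∀ d {n m} → Vec (V n) m → Set
  Nonvanishing d {n} s = Σ (Poly n d) λ q → VAll (λ x → ¬ p∣ eval q ⟦ x ⟧) s

  some-nonvanishing : ∀ {n d} {R : Poly n d → Set} {qs : List (Poly n d)} x → All R qs →
    T (not (allVanish qs x)) → ∃ λ q → R q × ¬ p∣ eval q ⟦ x ⟧
  some-nonvanishing x []             ()
  some-nonvanishing {qs = q ∷ qs} x (Rq ∷ Rqs) t with p∣? (eval q ⟦ x ⟧)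
  ... | no ¬z = q , Rq , ¬z
  ... | yes z = some-nonvanishing x Rqs (subst (λ b → T (not (b ∧ allVanish qs x))) (dec-true (p∣? (eval q ⟦ x ⟧)) z) t)

  -- If q vanishes at the new point x, add to it a polynomial vanishing on s but not at x.
  nonvanishing-∷ : ∀ {d n m} (s : Vec (V n) m) → Nonvanishing d s → ∀ x →
    (Σ (Poly n d) λ r → VanishesOn s r × ¬ p∣ eval r ⟦ x ⟧) → Nonvanishing d (x ∷ s)
  nonvanishing-∷ s (q , q≢0) x (r , r≡0 , r≢0) with p∣? (eval q ⟦ x ⟧)
  ... | no ¬z = q , ¬z ∷ q≢0
  ... | yes z = addP q r ,
    (λ h → r≢0 (∣m+n∣m⇒∣n (subst p∣_ (eval-addP q r ⟦ x ⟧) h) z)) ∷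
    VAll.map (λ {x} (¬z , z′) h → ¬z (∣m+n∣n⇒∣m (subst p∣_ (eval-addP q r ⟦ x ⟧) h) z′)) (VAll.zip (q≢0 , r≡0))

  module _ (d t K n : ℕ) (K-bound : K ℕ.* (p ^ d ∸ 1) ^ t ≤ (p ^ d) ^ t) where

    instance
      p^d^t≢0 : NonZero ((p ^ d) ^ t)
      p^d^t≢0 = ℕ.m^n≢0 (p ^ d) t {{ℕ.m^n≢0 p d {{prime⇒nonZero p-prime}}}}

    -- `K-bound` reads (1 - p^-d)^t ≤ 1/K, so a new point is bad with probability at most 1/K.
    few-bad : ∀ b → b ℕ.* (p ^ d) ^ t ≤ (p ^ d ∸ 1) ^ t ℕ.* p ^ n → K ℕ.* b ≤ p ^ n
    few-bad b h = ℕ.*-cancelʳ-≤ (K ℕ.* b) (p ^ n) ((p ^ d) ^ t) (begin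
      K ℕ.* b ℕ.* (p ^ d) ^ t               ≡⟨ ℕ.*-assoc K b _ ⟩
      K ℕ.* (b ℕ.* (p ^ d) ^ t)             ≤⟨ ℕ.*-monoʳ-≤ K h ⟩
      K ℕ.* ((p ^ d ∸ 1) ^ t ℕ.* p ^ n)     ≡⟨ sym (ℕ.*-assoc K _ _) ⟩
      K ℕ.* (p ^ d ∸ 1) ^ t ℕ.* p ^ n       ≤⟨ ℕ.*-monoˡ-≤ (p ^ n) K-bound ⟩
      (p ^ d) ^ t ℕ.* p ^ n                 ≡⟨ ℕ.*-comm ((p ^ d) ^ t) (p ^ n) ⟩
      p ^ n ℕ.* (p ^ d) ^ t                 ∎)
      where open ℕ.≤-Reasoning

    -- A point is kept when some form from `fewCommonZeros` is nonzero there; that form vanishes on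
    -- s and can repair the current one.
    extensions : ∀ {m} (s : Vec (V n) m) → m < dim (n ∸ t ℕ.* d) d → Nonvanishing d s →
      Σ (List (V n)) λ xs → Unique xs × All (λ x → Nonvanishing d (x ∷ s)) xs ×
        length xs ≤ p ^ n × K ℕ.* p ^ n ≤ K ℕ.* length xs ℕ.+ p ^ n
    extensions s m< s-ok with fewCommonZeros d t s m<
    ... | qs , qs-van , few =
      good , Unique.filter⁺ good? (points-unique n) ,
      All.map (λ {x} g → nonvanishing-∷ s s-ok x (some-nonvanishing x qs-van g)) (All.all-filter good? (points n)) ,
      ℕ.≤-trans (length-filter good? (points n)) (ℕ.≤-reflexive (length-points n)) ,
      (begin
        K ℕ.* p ^ n
          ≡⟨ cong (K ℕ.*_) (sym total) ⟩
        K ℕ.* (length good ℕ.+ count (allVanish qs))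
          ≡⟨ ℕ.*-distribˡ-+ K (length good) _ ⟩
        K ℕ.* length good ℕ.+ K ℕ.* count (allVanish qs)
          ≤⟨ ℕ.+-monoʳ-≤ (K ℕ.* length good) (few-bad _ few) ⟩
        K ℕ.* length good ℕ.+ p ^ n ∎)
      where
      open ℕ.≤-Reasoning
      good? = λ x → T? (not (allVanish qs x))
      good = filter good? (points n)
      𝟙-not : ∀ b → 𝟙 (not b) ℕ.+ 𝟙 b ≡ 1
      𝟙-not true  = refl
      𝟙-not false = refl
      total : length good ℕ.+ count (allVanish qs) ≡ p ^ n
      total = begin-equality
        length good ℕ.+ count (allVanish qs)
          ≡⟨ cong (ℕ._+ count (allVanish qs)) (length-filter≡Σ good? (points n)) ⟩
        count (λ x → not (allVanish qs x)) ℕ.+ count (allVanish qs)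
          ≡⟨ sym (Σ-+ (points n) _ _) ⟩
        Σ[ points n ] (λ x → 𝟙 (not (allVanish qs x)) ℕ.+ 𝟙 (allVanish qs x))
          ≡⟨ Σ-cong (points n) (λ x → 𝟙-not (allVanish qs x)) ⟩
        Σ[ points n ] (λ _ → 1)
          ≡⟨ Σ-points-const n 1 ⟩
        p ^ n ℕ.* 1
          ≡⟨ ℕ.*-identityʳ _ ⟩
        p ^ n ∎

    -- The clause on `tail` is for distinctness: extensions of different samples have different
    -- tails.
    extendAll : ∀ {m} → m < dim (n ∸ t ℕ.* d) d → (L : List (Vec (V n) m)) → Unique L → All (Nonvanishing d) L →
      Σ (List (Vec (V n) (suc m))) λ L′ → Unique L′ × All (Nonvanishing d) L′ ×
        (∀ {s} → s ∈ L′ → tail s ∈ L) × length L′ ≤ length L ℕ.* p ^ n ×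
        K ℕ.* (length L ℕ.* p ^ n) ≤ K ℕ.* length L′ ℕ.+ length L ℕ.* p ^ n
    extendAll m< [] _ _ = [] , [] , [] , (λ ()) , z≤n , ℕ.≤-reflexive (sym (ℕ.+-identityʳ _))
    extendAll m< (s ∷ L) (s∉L ∷ L-unique) (s-ok ∷ L-ok)
      with extensions s m< s-ok | extendAll m< L L-unique L-ok
    ... | xs , xs-unique , xs-ok , xs≤ , ≤xs | L′ , L′-unique , L′-ok , L′-tail , L′≤ , ≤L′ =
      List.map (_∷ s) xs List.++ L′ ,
      Unique.++⁺ (Unique.map⁺ ∷-injectiveˡ xs-unique) L′-unique
        (λ (v∈xs , v∈L′) → All.All¬⇒¬Any s∉L (subst (_∈ L) (tail≡s v∈xs) (L′-tail v∈L′))) ,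
      All.++⁺ (All.map⁺ xs-ok) L′-ok ,
      (λ v∈ → tail∈ (∈-++⁻ (List.map (_∷ s) xs) v∈)) ,
      subst (_≤ p ^ n ℕ.+ length L ℕ.* p ^ n) (sym length-L″) (ℕ.+-mono-≤ xs≤ L′≤) ,
      (begin
        K ℕ.* (p ^ n ℕ.+ length L ℕ.* p ^ n)
          ≡⟨ ℕ.*-distribˡ-+ K (p ^ n) _ ⟩
        K ℕ.* p ^ n ℕ.+ K ℕ.* (length L ℕ.* p ^ n)
          ≤⟨ ℕ.+-mono-≤ ≤xs ≤L′ ⟩
        (K ℕ.* length xs ℕ.+ p ^ n) ℕ.+ (K ℕ.* length L′ ℕ.+ length L ℕ.* p ^ n)
          ≡⟨ regroup K (length xs) (p ^ n) (length L′) (length L ℕ.* p ^ n) ⟩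
        K ℕ.* (length xs ℕ.+ length L′) ℕ.+ (p ^ n ℕ.+ length L ℕ.* p ^ n)
          ≡⟨ cong (λ l → K ℕ.* l ℕ.+ (p ^ n ℕ.+ length L ℕ.* p ^ n)) (sym length-L″) ⟩
        K ℕ.* length (List.map (_∷ s) xs List.++ L′) ℕ.+ (p ^ n ℕ.+ length L ℕ.* p ^ n) ∎)
      where
      open ℕ.≤-Reasoning
      tail≡s : ∀ {v} → v ∈ List.map (_∷ s) xs → tail v ≡ s
      tail≡s v∈ with ∈-map⁻ (_∷ s) v∈
      ... | _ , _ , refl = refl
      tail∈ : ∀ {v} → v ∈ List.map (_∷ s) xs ⊎ v ∈ L′ → tail v ∈ s ∷ L
      tail∈ (inj₁ v∈) = here (tail≡s v∈)
      tail∈ (inj₂ v∈) = there (L′-tail v∈)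
      length-L″ : length (List.map (_∷ s) xs List.++ L′) ≡ length xs ℕ.+ length L′
      length-L″ = trans (length-++ (List.map (_∷ s) xs)) (cong (ℕ._+ length L′) (length-map (_∷ s) xs))
      regroup : ∀ k a b c e → (k ℕ.* a ℕ.+ b) ℕ.+ (k ℕ.* c ℕ.+ e) ≡ k ℕ.* (a ℕ.+ c) ℕ.+ (b ℕ.+ e)
      regroup = solve-∀ℕ

    -- The union bound in counting form: each new point loses at most a fraction 1/K of all samples,
    -- so m points lose at most m/K.
    manyNonvanishing : ∀ m → m ≤ dim (n ∸ t ℕ.* d) d →
      Σ (List (Vec (V n) m)) λ L → Unique L × All (Nonvanishing d) L × length L ≤ p ^ (n ℕ.* m) ×
        K ℕ.* p ^ (n ℕ.* m) ≤ K ℕ.* length L ℕ.+ m ℕ.* p ^ (n ℕ.* m)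
    -- With no points chosen every form qualifies, even the zero form.
    manyNonvanishing zero _ = [] ∷ [] , [] ∷ [] , (zeroP n d , []) ∷ [] ,
      ℕ.≤-reflexive (sym p^n*0) , ℕ.≤-reflexive (trans (cong (K ℕ.*_) p^n*0) (sym (ℕ.+-identityʳ _)))
      where
      p^n*0 : p ^ (n ℕ.* 0) ≡ 1
      p^n*0 = cong (p ^_) (ℕ.*-zeroʳ n)
    manyNonvanishing (suc m) m< with manyNonvanishing m (ℕ.<⇒≤ m<)
    ... | L , L-unique , L-ok , L≤ , ≤L with extendAll m< L L-unique L-ok
    ...   | L′ , L′-unique , L′-ok , _ , L′≤ , ≤L′ = L′ , L′-unique , L′-ok ,
      ℕ.≤-trans L′≤ (ℕ.≤-trans (ℕ.*-monoˡ-≤ (p ^ n) L≤) (ℕ.≤-reflexive (trans (ℕ.*-comm X (p ^ n)) (sym p^n*suc)))) ,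
      (begin
        K ℕ.* p ^ (n ℕ.* suc m)
          ≡⟨ trans (cong (K ℕ.*_) p^n*suc) (swap K (p ^ n) X) ⟩
        p ^ n ℕ.* (K ℕ.* X)
          ≤⟨ ℕ.*-monoʳ-≤ (p ^ n) ≤L ⟩
        p ^ n ℕ.* (K ℕ.* length L ℕ.+ m ℕ.* X)
          ≡⟨ expand (p ^ n) K (length L) m X ⟩
        K ℕ.* (length L ℕ.* p ^ n) ℕ.+ m ℕ.* (p ^ n ℕ.* X)
          ≤⟨ ℕ.+-monoˡ-≤ (m ℕ.* (p ^ n ℕ.* X)) ≤L′ ⟩
        K ℕ.* length L′ ℕ.+ length L ℕ.* p ^ n ℕ.+ m ℕ.* (p ^ n ℕ.* X)
          -- The upper bound on the length of `L` turns a loss relative to `L` into one relative to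
          -- all samples.
          ≤⟨ ℕ.+-monoˡ-≤ (m ℕ.* (p ^ n ℕ.* X)) (ℕ.+-monoʳ-≤ (K ℕ.* length L′) (ℕ.*-monoˡ-≤ (p ^ n) L≤)) ⟩
        K ℕ.* length L′ ℕ.+ X ℕ.* p ^ n ℕ.+ m ℕ.* (p ^ n ℕ.* X)
          ≡⟨ collect (K ℕ.* length L′) X (p ^ n) m ⟩
        K ℕ.* length L′ ℕ.+ suc m ℕ.* (p ^ n ℕ.* X)
          ≡⟨ cong (λ z → K ℕ.* length L′ ℕ.+ suc m ℕ.* z) (sym p^n*suc) ⟩
        K ℕ.* length L′ ℕ.+ suc m ℕ.* p ^ (n ℕ.* suc m) ∎)
      where
      open ℕ.≤-Reasoning
      X = p ^ (n ℕ.* m)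
      p^n*suc : p ^ (n ℕ.* suc m) ≡ p ^ n ℕ.* X
      p^n*suc = trans (cong (p ^_) (ℕ.*-suc n m)) (ℕ.^-distribˡ-+-* p n (n ℕ.* m))
      swap : ∀ a b c → a ℕ.* (b ℕ.* c) ≡ b ℕ.* (a ℕ.* c)
      swap = solve-∀ℕ
      expand : ∀ b k l m x → b ℕ.* (k ℕ.* l ℕ.+ m ℕ.* x) ≡ k ℕ.* (l ℕ.* b) ℕ.+ m ℕ.* (b ℕ.* x)
      expand = solve-∀ℕ
      collect : ∀ a x b m → a ℕ.+ x ℕ.* b ℕ.+ m ℕ.* (b ℕ.* x) ≡ a ℕ.+ (1 ℕ.+ m) ℕ.* (b ℕ.* x)
      collect = solve-∀ℕ

-- Choice of constants and conclusion

theorem1p5 : (k p : ℕ) → 3 ≤ k → k ≤ p → Prime p → .{{_ : NonZero p}} →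
    Σ ℕ λ C → Σ ℕ λ d → 1 ≤ d × ((e : ℕ) → 1 ≤ e → Σ ℕ λ N → (n : ℕ) → N ≤ n →
    (m : ℕ) → SizeOK p k C n m →
    Σ (List (Vec (𝔽^ p n) m)) λ L →
    Unique L × All (Good p k d n m) L × (e ∸ 1) ℕ.* p ^ (n ℕ.* m) ≤ e ℕ.* length L)
theorem1p5 (suc zero) p (s≤s ())
theorem1p5 (suc (suc d)) p _ k≤p p-prime {{p≢0}} =
  -- Here k = d + 2. Level sets have density at least 1/p, which gives the second constant, and the
  -- threshold for n forces d ≤ n and l ≥ e + 2.
  slope q d ℕ.* 2 ^ d , p , ℕ.<⇒≤ 1<p , λ e _ → p ^ (2 ℕ.+ e) ℕ.+ d , go e
  where
  open ModPrime p p-prime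
  q = p ^ suc d
  instance
    q≢0 : NonZero q
    q≢0 = ℕ.m^n≢0 p (suc d)
  go : ∀ e n → p ^ (2 ℕ.+ e) ℕ.+ d ≤ n → ∀ m → SizeOK p (suc (suc d)) (slope q d ℕ.* 2 ^ d) n m →
    Σ (List (Vec (𝔽^ p n) m)) λ L → Unique L × All (Good p (suc (suc d)) p n m) L ×
      (e ∸ 1) ℕ.* p ^ (n ℕ.* m) ≤ e ℕ.* length L
  go e n N≤n m size with logFloor p 1<p n (ℕ.≤-trans (ℕ.m^n>0 p (2 ℕ.+ e)) (ℕ.m+n≤o⇒m≤o (p ^ (2 ℕ.+ e)) N≤n))
  ... | l , p^l≤n , n<
    -- K = e q^(2+l): since m ≤ q^(2+l), the total failure probability m/K is at most 1/e.
    with manyNonvanishing (suc d) (steps q e l) (e ℕ.* q ^ (2 ℕ.+ l)) n (steps-suffice q e l) m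
           (size⇒room q d e l n m (ℕ.m+n≤o⇒n≤o 2 2+e≤l) (ℕ.m+n≤o⇒m≤o 2 2+e≤l) d≤n size′)
       | ℕ.≤-trans (ℕ.m+n≤o⇒n≤o (l ℕ.* l ℕ.* (slope q d ℕ.* 2 ^ d) ℕ.* n ^ d) size′)
           (dim-bound p d n l 1<p d≤n n<)
    where
    d≤n : d ≤ n
    d≤n = ℕ.m+n≤o⇒n≤o (p ^ (2 ℕ.+ e)) N≤n
    2+e≤l : 2 ℕ.+ e ≤ l
    2+e≤l = ℕ.≮⇒≥ λ l< → ℕ.<⇒≱ n< (ℕ.≤-trans (ℕ.^-monoʳ-≤ p l<) (ℕ.m+n≤o⇒m≤o (p ^ (2 ℕ.+ e)) N≤n))
    size′ : l ℕ.* l ℕ.* (slope q d ℕ.* 2 ^ d) ℕ.* n ^ d ℕ.+ m ≤ dim (n ℕ.+ d) (suc d)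
    size′ = begin
      l ℕ.* l ℕ.* (slope q d ℕ.* 2 ^ d) ℕ.* n ^ d ℕ.+ m
        ≡⟨ cong (l ℕ.* l ℕ.* (slope q d ℕ.* 2 ^ d) ℕ.* n ^ d ℕ.+_) (sym (ℕ.*-identityʳ m)) ⟩
      l ℕ.* l ℕ.* (slope q d ℕ.* 2 ^ d) ℕ.* n ^ d ℕ.+ m ℕ.* 1
        -- The size hypothesis is applied to the rational l/1, with l the integer part of the
        -- logarithm of n to base p.
        ≤⟨ size l 1 ℕ.≤-refl (subst (p ^ l ≤_) (sym (ℕ.*-identityʳ n)) p^l≤n) ⟩
      ((n ℕ.+ suc (suc d) ∸ 2) choose suc d) ℕ.* 1
        ≡⟨ ℕ.*-identityʳ _ ⟩
      (n ℕ.+ suc (suc d) ∸ 2) choose suc d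
        ≡⟨ cong (_choose suc d) (ℕ.+-∸-assoc n {suc (suc d)} {2} (s≤s (s≤s z≤n))) ⟩
      (n ℕ.+ d) choose suc d
        ≡⟨ sym (dim≡C (n ℕ.+ d) (suc d)) ⟩
      dim (n ℕ.+ d) (suc d) ∎
      where open ℕ.≤-Reasoning
  ... | L , L-unique , L-ok , _ , large | m≤M = L , L-unique ,
    All.map (λ {s} (r , r≢0) → nonvanishing⇒good s r k≤p r≢0) L-ok ,
    success-fraction e (q ^ (2 ℕ.+ l)) m (p ^ (n ℕ.* m)) (length L) {{ℕ.m^n≢0 q (2 ℕ.+ l)}} m≤M large
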